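{- Fix a positive integer $n$. There exists a finite Jordan-measurable coloring of $\mathbb{R}^2$ such that no color-class contains an embedding of the $1$-skeleton of an $n$-dimensional box $[0,a_1]\times\cdots\times[0,a_n]$ with $a_1,\ldots,a_n\in(0,\infty)$ satisfying $a_1\cdots a_n=1$; that is, no color-class contains all of $2^n$ mutually distinct points $$z+r_1u_1+r_2u_2+\cdots+r_nu_n,\qquad (r_1,\ldots,r_n)\in\{0,1\}^n,$$ where $z\in\mathbb{R}^2$ and $u_1,\ldots,u_n\in\mathbb{R}^2$ are vectors with Euclidean lengths $|u_k|=a_k$ for $1\leq k\leq n$ such that $a_1\cdots a_n=1$.
   Context: A finite coloring of $\mathbb{R}^2$ is a partition of $\mathbb{R}^2$ into finitely many sets, called color-classes. It is Jordan-measurable if the boundary of every color-class has Lebesgue measure $0$. -}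

module Defs where

open import Algebra.Core using (Op₁; Op₂)
open import Algebra.Structures using (IsCommutativeRing)
open import Data.Bool using (Bool; true; false)
open import Data.Fin using (Fin)
open import Data.Nat using (ℕ; zero; suc)
open import Data.Product using (Σ; ∃; ∃!; _×_; _,_)
open import Data.Vec using (Vec; lookup)
open import Data.Vec.Functional using (Vector; foldr)
open import Level using (0ℓ) renaming (suc to lsuc)
open import Relation.Binary.Construct.StrictToNonStrict using ()
  renaming (_≤_ to NonStrict)
open import Relation.Binary.Core using (Rel)
open import Relation.Binary.PropositionalEquality using (_≡_; _≢_)
open import Relation.Binary.Structures using (IsStrictTotalOrder)
open import Relation.Unary using (Pred; _∈_; _∩_; ∁)

module Bounds {A : Set} (_≤_ : Rel A 0ℓ) where

  UpperBound : Pred A 0ℓ → Pred A 0ℓ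
  UpperBound P b = ∀ x → x ∈ P → x ≤ b

  LowerBound : Pred A 0ℓ → Pred A 0ℓ
  LowerBound P b = ∀ x → x ∈ P → b ≤ x

  IsSupremum : Pred A 0ℓ → Pred A 0ℓ
  IsSupremum P s = s ∈ UpperBound P × s ∈ LowerBound (UpperBound P)

  IsInfimum : Pred A 0ℓ → Pred A 0ℓ
  IsInfimum P i = i ∈ LowerBound P × i ∈ UpperBound (LowerBound P)

-- The classical axioms of a Dedekind-complete ordered field. They determine
-- the real numbers up to isomorphism, so a statement about ℝ is expressed as
-- a statement about an arbitrary model.
record CompleteOrderedField : Set (lsuc 0ℓ) where
  infixl 6 _+_
  infixl 7 _*_
  infix  8 -_
  infix  4 _<_ _≤_
  field
    ℝ                  : Set
    _+_ _*_            : Op₂ ℝ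
    -_                 : Op₁ ℝ
    0# 1#              : ℝ
    _<_                : Rel ℝ 0ℓ
    isCommutativeRing  : IsCommutativeRing _≡_ _+_ _*_ -_ 0# 1#
    0≢1                : 0# ≢ 1#
    inverse            : ∀ x → x ≢ 0# → ∃ λ y → x * y ≡ 1#
    isStrictTotalOrder : IsStrictTotalOrder _≡_ _<_
    +-monoʳ-<          : ∀ z {x y} → x < y → z + x < z + y
    *-pos              : ∀ {x y} → 0# < x → 0# < y → 0# < x * y

  _≤_ : Rel ℝ 0ℓ
  _≤_ = NonStrict _≡_ _<_

  open Bounds _≤_ public

  field
    complete : (P : Pred ℝ 0ℓ) → ∃ P → ∃ (UpperBound P) → ∃ (IsSupremum P)

module Plane (R : CompleteOrderedField) where
  open CompleteOrderedField R public

  infixl 6 _-_ _⊕_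
  infixl 7 _·_

  _-_ : Op₂ ℝ
  x - y = x + (- y)

  product : ∀ {n} → Vector ℝ n → ℝ
  product = foldr _*_ 1#

  ℝ² : Set
  ℝ² = ℝ × ℝ

  0² : ℝ²
  0² = 0# , 0#

  _⊕_ : Op₂ ℝ²
  (x , y) ⊕ (x′ , y′) = x + x′ , y + y′

  _·_ : ℝ → ℝ² → ℝ²
  c · (x , y) = c * x , c * y

  normSq : ℝ² → ℝ
  normSq (x , y) = x * x + y * y

  -- `HasLength u a` says that a is the nonnegative square root of |u|².
  HasLength : ℝ² → Pred ℝ 0ℓ
  HasLength u a = 0# ≤ a × a * a ≡ normSq u

  Ball : ℝ² → ℝ → Pred ℝ² 0ℓ
  Ball (x , y) ε (x′ , y′) = normSq (x′ - x , y′ - y) < ε * ε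

  Closure : Pred ℝ² 0ℓ → Pred ℝ² 0ℓ
  Closure A z = ∀ ε → 0# < ε → ∃ λ w → w ∈ Ball z ε × w ∈ A

  Boundary : Pred ℝ² 0ℓ → Pred ℝ² 0ℓ
  Boundary A = Closure A ∩ Closure (∁ A)

  record Rectangle : Set where
    field
      left right bottom top : ℝ
      left≤right            : left ≤ right
      bottom≤top            : bottom ≤ top

    area : ℝ
    area = (right - left) * (top - bottom)

    Contains : Pred ℝ² 0ℓ
    Contains (x , y) = (left ≤ x × x ≤ right) × (bottom ≤ y × y ≤ top)

  open Rectangle public using (area; Contains)

  partialSum : (ℕ → ℝ) → ℕ → ℝ
  partialSum f zero    = 0#
  partialSum f (suc N) = partialSum f N + f N

  -- The sum of a convergent series, provided that its terms are nonnegative.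
  HasSum : (ℕ → ℝ) → Pred ℝ 0ℓ
  HasSum f = IsSupremum (λ t → ∃ λ N → t ≡ partialSum f N)

  -- The finite total areas of countable covers of A by rectangles. Covers of
  -- infinite total area are left out; they do not affect a finite infimum.
  CoverArea : Pred ℝ² 0ℓ → Pred ℝ 0ℓ
  CoverArea A s = Σ (ℕ → Rectangle) λ Q →
    (∀ z → z ∈ A → ∃ λ k → z ∈ Contains (Q k)) × HasSum (λ k → area (Q k)) s

  IsOuterMeasure : Pred ℝ² 0ℓ → Pred ℝ 0ℓ
  IsOuterMeasure A = IsInfimum (CoverArea A)

  -- Sets of outer measure 0 are Lebesgue measurable, so this is the same as
  -- having Lebesgue measure 0.
  LebesgueNull : Pred ℝ² 0ℓ → Set
  LebesgueNull A = IsOuterMeasure A 0#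

  record FiniteColoring : Set (lsuc 0ℓ) where
    field
      #colors   : ℕ
      class     : Fin #colors → Pred ℝ² 0ℓ
      partition : ∀ z → ∃! _≡_ λ i → z ∈ class i

  open FiniteColoring public

  JordanMeasurable : FiniteColoring → Set
  JordanMeasurable χ = ∀ i → LebesgueNull (Boundary (class χ i))

  bit : Bool → ℝ
  bit false = 0#
  bit true  = 1#

  -- z + r₁u₁ + ⋯ + rₙuₙ
  vertex : ∀ {n} → ℝ² → Vector ℝ² n → Vec Bool n → ℝ²
  vertex z u r = z ⊕ foldr _⊕_ 0² (λ k → bit (lookup r k) · u k)

{-# OPTIONS --safe #-}
-- Identify ℝ² with ℂ and let f(z) = K zⁿ. The alternating sum of f over the
-- vertices z + r₁u₁ + ⋯ + rₙuₙ is the n-th difference K n! u₁⋯uₙ, whose modulus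
-- is T = K n!. Colour z by the residues modulo 2T of the integer parts of the
-- coordinates of f, evaluated not at z but at a grid point near z at which f
-- differs from f(z) by at most 1. If all vertices have the same colour, then the
-- alternating sum is within 2ⁿ⁺¹, in each coordinate, of the lattice (2Tℤ)²;
-- this is impossible for a number of modulus T once T ≥ 2ⁿ⁺².
--
-- The grid is refined depending on the unit square that contains z, so there are
-- only countably many grid lines. Off them the colouring is locally constant;
-- hence the boundaries of the classes are null.
module Submission where

open import Defs
open import Algebra.Bundles using (CommutativeRing)
open import Algebra.Core using (Op₁; Op₂)
open import Algebra.Solver.Ring.AlmostCommutativeRing using (fromCommutativeRing; _-Raw-AlmostCommutative⟶_)
open import Algebra.Structures using (IsCommutativeRing)
open import Axiom.ExcludedMiddle using (ExcludedMiddle)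
open import Data.Bool using (Bool; true; false)
open import Data.Empty using (⊥-elim)
open import Data.Fin using (Fin; toℕ; fromℕ<; combine; remQuot)
import Data.Fin.Properties as Fin
open import Data.Integer as ℤ using (ℤ; 0ℤ; 1ℤ; -[1+_]; +[1+_]; _⊖_; ∣_∣)
open import Data.Integer.DivMod using (_/ℕ_; _%ℕ_; n%ℕd<d; a≡a%ℕn+[a/ℕn]*n)
import Data.Integer.Properties as ℤ
open import Data.Maybe using (Maybe; just; nothing; map)
open import Data.Nat as ℕ using (ℕ; zero; suc; _!; _^_; NonZero)
import Data.Nat.Properties as ℕ
open import Data.Product using (Σ; ∃; _×_; _,_; proj₁; proj₂)
open import Data.Sum using (_⊎_; inj₁; inj₂)
open import Data.Vec using (Vec; []; _∷_)
open import Data.Vec.Functional using (Vector; head; tail)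
open import Function using (_∘_)
open import Function.Definitions using (Injective; StrictlySurjective)
open import Level using (0ℓ)
import Relation.Binary.Construct.StrictToNonStrict as ToNonStrict
open import Relation.Binary.Definitions using (tri<; tri≈; tri>)
open import Relation.Binary.PropositionalEquality
open import Relation.Binary.Structures using (IsStrictTotalOrder)
open import Relation.Nullary using (¬_; yes; no)
open import Relation.Nullary.Decidable using (dec⇒maybe)
open import Relation.Unary using (Pred; _∈_)

-- Integer multiples of 1 in a commutative ring, and a ring solver over them.

module IntegerScalars {A : Set} {_+_ _*_ : Op₂ A} { -_ : Op₁ A} {0# 1# : A}
                      (isCommutativeRing : IsCommutativeRing _≡_ _+_ _*_ -_ 0# 1#) where

  commutativeRing : CommutativeRing 0ℓ 0ℓ
  commutativeRing = record { isCommutativeRing = isCommutativeRing }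

  open CommutativeRing commutativeRing using (ring; semiring; +-identityˡ; +-identityʳ; -‿inverseʳ; +-comm; +-assoc)
  open import Algebra.Properties.Ring ring
  open import Algebra.Properties.Semiring.Mult.TCOptimised semiring
    renaming (_×_ to _⋆_)

  -- With this version of the multiple, `ν 1` is `1#` by computation, so a solver constant `con 1ℤ`
  -- stands for `1#` without any rewriting.
  ν : ℕ → A
  ν n = n ⋆ 1#

  ν-suc : ∀ n → ν (suc n) ≡ 1# + ν n
  ν-suc n = 1+× n 1#

  ν-+ : ∀ m n → ν (m ℕ.+ n) ≡ ν m + ν n
  ν-+ = ×-homo-+ 1#

  ν-* : ∀ m n → ν (m ℕ.* n) ≡ ν m * ν n
  ν-* = ×1-homo-*

  ι : ℤ → A
  ι (ℤ.+ n)    = ν n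
  ι -[1+ n ] = - ν (suc n)

  ι-neg : ∀ i → ι (ℤ.- i) ≡ - ι i
  ι-neg (ℤ.+ zero)  = sym -0#≈0#
  ι-neg +[1+ n ]  = refl
  ι-neg -[1+ n ]  = sym (-‿involutive _)

  ι-⊖ : ∀ m n → ι (m ⊖ n) ≡ ν m + (- ν n)
  ι-⊖ m       zero    = sym (trans (cong (ν m +_) -0#≈0#) (+-identityʳ _))
  ι-⊖ zero    (suc n) = sym (+-identityˡ _)
  ι-⊖ (suc m) (suc n) = begin
    ι (suc m ⊖ suc n)                  ≡⟨ cong ι (ℤ.[1+m]⊖[1+n]≡m⊖n m n) ⟩
    ι (m ⊖ n)                          ≡⟨ ι-⊖ m n ⟩
    ν m + (- ν n)                      ≡⟨ cong (_+ (- ν n)) (+-identityʳ _) ⟨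
    (ν m + 0#) + (- ν n)               ≡⟨ cong (λ x → (ν m + x) + (- ν n)) (-‿inverseʳ 1#) ⟨
    (ν m + (1# + (- 1#))) + (- ν n)    ≡⟨ cong (_+ (- ν n)) (+-assoc _ _ _) ⟨
    ((ν m + 1#) + (- 1#)) + (- ν n)    ≡⟨ +-assoc _ _ _ ⟩
    (ν m + 1#) + ((- 1#) + (- ν n))    ≡⟨ cong₂ _+_ (trans (+-comm _ _) (sym (ν-suc m)))
                                            (trans (-‿+-comm _ _) (cong -_ (sym (ν-suc n)))) ⟩
    ν (suc m) + (- ν (suc n))          ∎
    where open ≡-Reasoning

  ι-+ : ∀ i j → ι (i ℤ.+ j) ≡ ι i + ι j
  ι-+ (ℤ.+ m)    (ℤ.+ n)    = ν-+ m n
  ι-+ (ℤ.+ m)    -[1+ n ] = ι-⊖ m (suc n)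
  ι-+ -[1+ m ] (ℤ.+ n)    = trans (ι-⊖ n (suc m)) (+-comm _ _)
  ι-+ -[1+ m ] -[1+ n ] = begin
    - ν (suc (suc (m ℕ.+ n)))     ≡⟨ cong (λ k → - ν (suc k)) (ℕ.+-suc m n) ⟨
    - ν (suc m ℕ.+ suc n)         ≡⟨ cong -_ (ν-+ (suc m) (suc n)) ⟩
    - (ν (suc m) + ν (suc n))     ≡⟨ -‿+-comm _ _ ⟨
    (- ν (suc m)) + (- ν (suc n)) ∎
    where open ≡-Reasoning

  ι-+* : ∀ m j → ι (ℤ.+ m ℤ.* j) ≡ ν m * ι j
  ι-+* m (ℤ.+ n)    = trans (cong ι (sym (ℤ.pos-* m n))) (ν-* m n)
  ι-+* m -[1+ n ] = begin
    ι (ℤ.+ m ℤ.* (ℤ.- +[1+ n ]))    ≡⟨ cong ι (ℤ.neg-distribʳ-* (ℤ.+ m) +[1+ n ]) ⟨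
    ι (ℤ.- (ℤ.+ m ℤ.* +[1+ n ]))    ≡⟨ ι-neg (ℤ.+ m ℤ.* +[1+ n ]) ⟩
    - ι (ℤ.+ m ℤ.* +[1+ n ])        ≡⟨ cong -_ (ι-+* m +[1+ n ]) ⟩
    - (ν m * ν (suc n))           ≡⟨ -‿distribʳ-* _ _ ⟩
    ν m * (- ν (suc n))           ∎
    where open ≡-Reasoning

  ι-* : ∀ i j → ι (i ℤ.* j) ≡ ι i * ι j
  ι-* (ℤ.+ m)    j = ι-+* m j
  ι-* -[1+ m ] j = begin
    ι ((ℤ.- +[1+ m ]) ℤ.* j)      ≡⟨ cong ι (ℤ.neg-distribˡ-* +[1+ m ] j) ⟨
    ι (ℤ.- (+[1+ m ] ℤ.* j))      ≡⟨ ι-neg (+[1+ m ] ℤ.* j) ⟩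
    - ι (+[1+ m ] ℤ.* j)          ≡⟨ cong -_ (ι-+* (suc m) j) ⟩
    - (ν (suc m) * ι j)           ≡⟨ -‿distribˡ-* _ _ ⟩
    (- ν (suc m)) * ι j           ∎
    where open ≡-Reasoning

  ι-homomorphism : CommutativeRing.rawRing ℤ.+-*-commutativeRing -Raw-AlmostCommutative⟶ fromCommutativeRing commutativeRing
  ι-homomorphism = record
    { ⟦_⟧ = ι ; +-homo = ι-+ ; *-homo = ι-* ; -‿homo = ι-neg ; 0-homo = refl ; 1-homo = refl }

  -- Integer coefficients have decidable equality, and this is what lets the solver cancel terms.
  open import Algebra.Solver.Ring _ (fromCommutativeRing commutativeRing) ι-homomorphism
    (λ i j → map (cong ι) (dec⇒maybe (i ℤ.≟ j))) public
    using (solve; _:=_; _:+_; _:*_; _:-_; :-_; con)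

-- Finite differences and alternating sums.

module FiniteDifferences {A : Set} {_+_ _*_ : Op₂ A} { -_ : Op₁ A} {0# 1# : A}
                         (isCommutativeRing : IsCommutativeRing _≡_ _+_ _*_ -_ 0# 1#) where

  open IntegerScalars isCommutativeRing

  Δ : A → (A → A) → A → A
  Δ u f z = f (z + u) + (- f z)

  -- f behaves like a polynomial of degree at most n whose coefficient of zⁿ is c.
  HasLeading : ℕ → A → (A → A) → Set
  HasLeading zero    c f = ∀ z → f z ≡ c
  HasLeading (suc n) c f = ∀ u → HasLeading n (ν (suc n) * (c * u)) (Δ u f)

  HasLeading-cong : ∀ n {c d f g} → c ≡ d → f ≗ g → HasLeading n c f → HasLeading n d g
  HasLeading-cong zero    refl f≗g h z = trans (sym (f≗g z)) (h z)
  HasLeading-cong (suc n) refl f≗g h u =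
    HasLeading-cong n refl (λ z → cong₂ (λ x y → x + (- y)) (f≗g (z + u)) (f≗g z)) (h u)

  HasLeading-+ : ∀ n {c d f g} → HasLeading n c f → HasLeading n d g →
                 HasLeading n (c + d) (λ z → f z + g z)
  HasLeading-+ zero    h k z = cong₂ _+_ (h z) (k z)
  HasLeading-+ (suc n) {c} {d} {f} {g} h k u = HasLeading-cong n
    (solve 4 (λ m c d u → m :* (c :* u) :+ m :* (d :* u) := m :* ((c :+ d) :* u)) refl (ν (suc n)) c d u)
    (λ z → solve 4 (λ a b x y → (a :- b) :+ (x :- y) := (a :+ x) :- (b :+ y)) refl
             (f (z + u)) (f z) (g (z + u)) (g z))
    (HasLeading-+ n (h u) (k u))

  HasLeading-* : ∀ n {c f} k → HasLeading n c f → HasLeading n (k * c) (λ z → k * f z)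
  HasLeading-* zero    k h z = cong (k *_) (h z)
  HasLeading-* (suc n) {c} {f} k h u = HasLeading-cong n
    (solve 4 (λ m k c u → k :* (m :* (c :* u)) := m :* ((k :* c) :* u)) refl (ν (suc n)) k c u)
    (λ z → solve 3 (λ k a b → k :* (a :- b) := k :* a :- k :* b) refl k (f (z + u)) (f z))
    (HasLeading-* n k (h u))

  -- Differences commute with translations.
  HasLeading-shift : ∀ n {c f} v → HasLeading n c f → HasLeading n c (λ z → f (z + v))
  HasLeading-shift zero    v h z = h (z + v)
  HasLeading-shift (suc n) {c} {f} v h u = HasLeading-cong n refl
    (λ z → cong (λ w → f w + (- f (z + v)))
             (solve 3 (λ z u v → (z :+ v) :+ u := (z :+ u) :+ v) refl z u v))
    (HasLeading-shift n v (h u))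

  -- By the product rule, the difference of z f(z) is z times the difference of f, plus u f(z + u).
  -- The first term has leading coefficient (n + 1)cu by induction and the second has cu, which
  -- together give (n + 2)cu.
  HasLeading-z* : ∀ n {c f} → HasLeading n c f → HasLeading (suc n) c (λ z → z * f z)
  HasLeading-z* zero {c} {f} h u z = begin
    ((z + u) * f (z + u)) + (- (z * f z))  ≡⟨ cong₂ (λ x y → ((z + u) * x) + (- (z * y))) (h (z + u)) (h z) ⟩
    ((z + u) * c) + (- (z * c))            ≡⟨ solve 3 (λ z u c → (z :+ u) :* c :- z :* c := con 1ℤ :* (c :* u)) refl z u c ⟩
    1# * (c * u)                           ∎
    where open ≡-Reasoning
  HasLeading-z* (suc n) {c} {f} h u = HasLeading-cong (suc n)
    (trans (solve 3 (λ m c u → m :* (c :* u) :+ u :* c := (con 1ℤ :+ m) :* (c :* u)) refl (ν (suc n)) c u)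
           (cong (_* (c * u)) (sym (ν-suc (suc n)))))
    (λ z → solve 4 (λ z u a b → z :* (a :- b) :+ u :* a := (z :+ u) :* a :- z :* b) refl z u (f (z + u)) (f z))
    (HasLeading-+ (suc n) (HasLeading-z* n (h u)) (HasLeading-* (suc n) u (HasLeading-shift (suc n) u h)))

  -- The sign of a vertex is the parity of its number of `false` bits; the recursion makes the sum
  -- an iterated difference.
  alternatingSum : ∀ n → (Vec Bool n → A) → A
  alternatingSum zero    φ = φ []
  alternatingSum (suc n) φ = alternatingSum n (φ ∘ (true ∷_)) + (- alternatingSum n (φ ∘ (false ∷_)))

  alternatingSum-cong : ∀ n {φ ψ} → φ ≗ ψ → alternatingSum n φ ≡ alternatingSum n ψ
  alternatingSum-cong zero    φ≗ψ = φ≗ψ []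
  alternatingSum-cong (suc n) φ≗ψ =
    cong₂ (λ x y → x + (- y)) (alternatingSum-cong n (φ≗ψ ∘ _)) (alternatingSum-cong n (φ≗ψ ∘ _))

  alternatingSum-+ : ∀ n φ ψ → alternatingSum n (λ r → φ r + ψ r) ≡ alternatingSum n φ + alternatingSum n ψ
  alternatingSum-+ zero    φ ψ = refl
  alternatingSum-+ (suc n) φ ψ = trans
    (cong₂ (λ x y → x + (- y)) (alternatingSum-+ n _ _) (alternatingSum-+ n _ _))
    (solve 4 (λ a b x y → (a :+ x) :- (b :+ y) := (a :- b) :+ (x :- y)) refl _ _ _ _)

  alternatingSum-neg : ∀ n φ → alternatingSum n (λ r → - φ r) ≡ - alternatingSum n φ
  alternatingSum-neg zero    φ = refl
  alternatingSum-neg (suc n) φ = trans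
    (cong₂ (λ x y → x + (- y)) (alternatingSum-neg n _) (alternatingSum-neg n _))
    (solve 2 (λ a b → (:- a) :- (:- b) := :- (a :- b)) refl _ _)

  -- This eliminates the residue shared by vertices of one colour. For n = 0 the single term would
  -- survive.
  alternatingSum-const : ∀ n .{{_ : NonZero n}} c → alternatingSum n (λ _ → c) ≡ 0#
  alternatingSum-const (suc n) c = solve 1 (λ x → x :- x := con 0ℤ) refl _

  alternatingSum-closed : (P : A → Set) → (∀ {x y} → P x → P y → P (x + (- y))) →
                          ∀ n {φ} → (∀ r → P (φ r)) → P (alternatingSum n φ)
  alternatingSum-closed P P-sub zero    h = h []
  alternatingSum-closed P P-sub (suc n) h =
    P-sub (alternatingSum-closed P P-sub n (h ∘ _)) (alternatingSum-closed P P-sub n (h ∘ _))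

  -- Equals c n! u₁⋯uₙ, in the order in which the differences produce the factors.
  boxVolume : ∀ n → A → Vector A n → A
  boxVolume zero    c u = c
  boxVolume (suc n) c u = boxVolume n (ν (suc n) * (c * head u)) (tail u)

-- Inequalities in an ordered field.

module OrderedField (R : CompleteOrderedField) where

  open Plane R public
  open IntegerScalars isCommutativeRing public
  open IsCommutativeRing isCommutativeRing public using (+-comm)
  open IsStrictTotalOrder isStrictTotalOrder public
    using (compare; irrefl; <-resp-≈; <-respʳ-≈; <-respˡ-≈) renaming (trans to <-trans)

  opaque
    ≤-refl : ∀ {x} → x ≤ x
    ≤-refl = inj₂ refl

    ≤-trans : ∀ {x y z} → x ≤ y → y ≤ z → x ≤ z
    ≤-trans = ToNonStrict.trans _≡_ _<_ isEquivalence <-resp-≈ <-trans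

    <-≤-trans : ∀ {x y z} → x < y → y ≤ z → x < z
    <-≤-trans = ToNonStrict.<-≤-trans _≡_ _<_ <-trans <-respʳ-≈

    ≤-<-trans : ∀ {x y z} → x ≤ y → y < z → x < z
    ≤-<-trans = ToNonStrict.≤-<-trans _≡_ _<_ sym <-trans <-respˡ-≈

    ≤⇒≯ : ∀ {x y} → x ≤ y → ¬ y < x
    ≤⇒≯ x≤y y<x = irrefl refl (≤-<-trans x≤y y<x)

    ≤-<-connex : ∀ x y → x ≤ y ⊎ y < x
    ≤-<-connex x y with compare x y
    ... | tri< x<y _ _ = inj₁ (inj₁ x<y)
    ... | tri≈ _ x≡y _ = inj₁ (inj₂ x≡y)
    ... | tri> _ _ y<x = inj₂ y<x

    -- Inequalities are proved by exhibiting the difference of the two sides as a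
    -- manifestly nonnegative (positive) expression.

    gap-< : ∀ {x y} → x < y → 0# < y - x
    gap-< {x} {y} x<y = subst₂ _<_
      (solve 1 (λ x → :- x :+ x := con 0ℤ) refl x) (+-comm _ _) (+-monoʳ-< (- x) x<y)

    gap-≤ : ∀ {x y} → x ≤ y → 0# ≤ y - x
    gap-≤ (inj₁ x<y)      = inj₁ (gap-< x<y)
    gap-≤ {x} (inj₂ refl) = inj₂ (solve 1 (λ x → con 0ℤ := x :- x) refl x)

    by-gap-< : ∀ {x y e} → 0# < e → e ≡ y - x → x < y
    by-gap-< {x} {y} 0<e refl = subst₂ _<_
      (solve 1 (λ x → x :+ con 0ℤ := x) refl x)
      (solve 2 (λ x y → x :+ (y :- x) := y) refl x y) (+-monoʳ-< x 0<e)

    by-gap-≤ : ∀ {x y e} → 0# ≤ e → e ≡ y - x → x ≤ y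
    by-gap-≤ (inj₁ 0<e) eq = inj₁ (by-gap-< 0<e eq)
    by-gap-≤ {x} {y} (inj₂ refl) eq = inj₂ (begin
      x              ≡⟨ solve 1 (λ x → x := x :+ con 0ℤ) refl x ⟩
      x + 0#         ≡⟨ cong (x +_) eq ⟩
      x + (y - x)    ≡⟨ solve 2 (λ x y → x :+ (y :- x) := y) refl x y ⟩
      y              ∎)
      where open ≡-Reasoning

    +-pos : ∀ {x y} → 0# < x → 0# ≤ y → 0# < x + y
    +-pos {x} {y} 0<x 0≤y = <-≤-trans 0<x (by-gap-≤ 0≤y (solve 2 (λ x y → y := (x :+ y) :- x) refl x y))

    +-nonneg : ∀ {x y} → 0# ≤ x → 0# ≤ y → 0# ≤ x + y
    +-nonneg {x} {y} 0≤x 0≤y = ≤-trans 0≤x (by-gap-≤ 0≤y (solve 2 (λ x y → y := (x :+ y) :- x) refl x y))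

    *-nonneg : ∀ {x y} → 0# ≤ x → 0# ≤ y → 0# ≤ x * y
    *-nonneg (inj₁ 0<x) (inj₁ 0<y) = inj₁ (*-pos 0<x 0<y)
    *-nonneg {x} 0≤x (inj₂ refl)   = inj₂ (solve 1 (λ x → con 0ℤ := x :* con 0ℤ) refl x)
    *-nonneg {_} {y} (inj₂ refl) _ = inj₂ (solve 1 (λ y → con 0ℤ := con 0ℤ :* y) refl y)

    square-nonneg : ∀ x → 0# ≤ x * x
    square-nonneg x with ≤-<-connex 0# x
    ... | inj₁ 0≤x = *-nonneg 0≤x 0≤x
    ... | inj₂ x<0 = subst (0# ≤_) (solve 1 (λ x → (con 0ℤ :- x) :* (con 0ℤ :- x) := x :* x) refl x)
                       (*-nonneg (inj₁ (gap-< x<0)) (inj₁ (gap-< x<0)))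

    0<1 : 0# < 1#
    0<1 with square-nonneg 1#
    ... | inj₁ 0<1² = subst (0# <_) (solve 0 (con 1ℤ :* con 1ℤ := con 1ℤ) refl) 0<1²
    ... | inj₂ 0≡1² = ⊥-elim (0≢1 (trans 0≡1² (solve 0 (con 1ℤ :* con 1ℤ := con 1ℤ) refl)))

    -- Stands in for a division by 2 in the bound for products.
    halve-nonneg : ∀ {x} → 0# ≤ x + x → 0# ≤ x
    halve-nonneg {x} 0≤2x with ≤-<-connex 0# x
    ... | inj₁ 0≤x = 0≤x
    ... | inj₂ x<0 = ⊥-elim (≤⇒≯ 0≤2x (by-gap-< (+-pos (gap-< x<0) (inj₁ (gap-< x<0)))
            (solve 1 (λ x → (con 0ℤ :- x) :+ (con 0ℤ :- x) := con 0ℤ :- (x :+ x)) refl x)))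

    square-cancel-≤ : ∀ {x y} → 0# ≤ y → x * x ≤ y * y → x ≤ y
    square-cancel-≤ {x} {y} 0≤y x²≤y² with ≤-<-connex x y
    ... | inj₁ x≤y = x≤y
    ... | inj₂ y<x = ⊥-elim (≤⇒≯ x²≤y² (by-gap-< (*-pos (gap-< y<x) (+-pos (≤-<-trans 0≤y y<x) 0≤y))
            (solve 2 (λ x y → (x :- y) :* (x :+ y) := x :* x :- y :* y) refl x y)))

    positive-inverse : ∀ {x} → 0# < x → ∃ λ y → 0# < y × x * y ≡ 1#
    positive-inverse {x} 0<x with inverse x (λ x≡0 → irrefl (sym x≡0) 0<x)
    ... | y , xy≡1 with ≤-<-connex y 0#
    ...   | inj₂ 0<y = y , 0<y , xy≡1
    ...   | inj₁ y≤0 = ⊥-elim (≤⇒≯ (by-gap-≤ (*-nonneg (inj₁ 0<x) (gap-≤ y≤0)) (begin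
              x * (0# - y)    ≡⟨ solve 2 (λ x y → x :* (con 0ℤ :- y) := con 0ℤ :- x :* y) refl x y ⟩
              0# - x * y      ≡⟨ cong (λ z → 0# - z) xy≡1 ⟩
              0# - 1#         ∎)) 0<1)
      where open ≡-Reasoning

    *-monoˡ-≤ : ∀ {h x y} → 0# ≤ h → x ≤ y → x * h ≤ y * h
    *-monoˡ-≤ {h} {x} {y} 0≤h x≤y = by-gap-≤ (*-nonneg (gap-≤ x≤y) 0≤h)
      (solve 3 (λ h x y → (y :- x) :* h := y :* h :- x :* h) refl h x y)

    *-monoˡ-< : ∀ {h x y} → 0# < h → x < y → x * h < y * h
    *-monoˡ-< {h} {x} {y} 0<h x<y = by-gap-< (*-pos (gap-< x<y) 0<h)
      (solve 3 (λ h x y → (y :- x) :* h := y :* h :- x :* h) refl h x y)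

    ν-nonneg : ∀ n → 0# ≤ ν n
    ν-nonneg zero    = ≤-refl
    ν-nonneg (suc n) = subst (0# ≤_) (sym (ν-suc n)) (+-nonneg (inj₁ 0<1) (ν-nonneg n))

    ν-mono-≤ : ∀ {m n} → m ℕ.≤ n → ν m ≤ ν n
    ν-mono-≤ {m} {n} m≤n = by-gap-≤ (ν-nonneg (n ℕ.∸ m)) (begin
      ν (n ℕ.∸ m)                      ≡⟨ solve 2 (λ a b → b := (a :+ b) :- a) refl (ν m) (ν (n ℕ.∸ m)) ⟩
      (ν m + ν (n ℕ.∸ m)) - ν m        ≡⟨ cong (_- ν m) (ν-+ m (n ℕ.∸ m)) ⟨
      ν (m ℕ.+ (n ℕ.∸ m)) - ν m        ≡⟨ cong (λ k → ν k - ν m) (ℕ.m+[n∸m]≡n m≤n) ⟩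
      ν n - ν m                        ∎)
      where open ≡-Reasoning

    ν-mono-< : ∀ {m n} → m ℕ.< n → ν m < ν n
    ν-mono-< {m} m<n = <-≤-trans (by-gap-< 0<1 (trans
      (solve 1 (λ a → con 1ℤ := (con 1ℤ :+ a) :- a) refl (ν m)) (cong (_- ν m) (sym (ν-suc m))))) (ν-mono-≤ m<n)

    ι-mono-≤ : ∀ {i j} → i ℤ.≤ j → ι i ≤ ι j
    ι-mono-≤ {i} {j} i≤j = by-gap-≤ (nonneg (ℤ.i≤j⇒0≤j-i i≤j)) (trans (ι-+ j (ℤ.- i)) (cong (ι j +_) (ι-neg i)))
      where
      nonneg : ∀ {k} → 0ℤ ℤ.≤ k → 0# ≤ ι k
      nonneg {ℤ.+ n} _ = ν-nonneg n

    ι-suc : ∀ i → ι (ℤ.suc i) ≡ ι i + 1#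
    ι-suc i = trans (ι-+ 1ℤ i) (+-comm _ _)

    -- The discreteness of the integers inside ℝ. Both the uniqueness of cells and the separation
    -- from the lattice rest on it.
    ι-<-suc⇒≤ : ∀ {i j} → ι i < ι j + 1# → i ℤ.≤ j
    ι-<-suc⇒≤ {i} {j} i<j+1 with i ℤ.≤? j
    ... | yes i≤j = i≤j
    ... | no i≰j  = ⊥-elim (≤⇒≯ (subst (_≤ ι i) (ι-suc j)
                      (ι-mono-≤ (ℤ.i<j⇒suc[i]≤j (ℤ.≰⇒> i≰j)))) i<j+1)

  -- Half-open, so that for positive `h` the cells partition the line.
  InCell : ℝ → ℝ → ℤ → Set
  InCell h x i = ι i * h ≤ x × x < (ι i + 1#) * h

  opaque
    InCell-unique : ∀ {h x} i j → 0# < h → InCell h x i → InCell h x j → i ≡ j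
    InCell-unique {h} {x} i j 0<h (i≤x , x<i+1) (j≤x , x<j+1) =
      ℤ.≤-antisym (index-≤ i≤x x<j+1) (index-≤ j≤x x<i+1)
      where
      index-≤ : ∀ {i j} → ι i * h ≤ x → x < (ι j + 1#) * h → i ℤ.≤ j
      index-≤ {i} {j} i≤x x<j+1 with ≤-<-connex (ι j + 1#) (ι i)
      ... | inj₁ j+1≤i = ⊥-elim (≤⇒≯ (≤-trans (*-monoˡ-≤ (inj₁ 0<h) j+1≤i) i≤x) x<j+1)
      ... | inj₂ i<j+1 = ι-<-suc⇒≤ i<j+1

  -- Expresses that the absolute value of `x` is at most `c`, without introducing absolute values.
  Within : ℝ → ℝ → Set
  Within c x = - c ≤ x × x ≤ c

  opaque
    within-gap : ∀ {c x} → Within c x → 0# ≤ c + x × 0# ≤ c - x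
    within-gap {c} {x} (l , u) =
      subst (0# ≤_) (solve 2 (λ c x → x :- (:- c) := c :+ x) refl c x) (gap-≤ l) , gap-≤ u

    by-gap-within : ∀ {c x e e′} → 0# ≤ e → e ≡ c + x → 0# ≤ e′ → e′ ≡ c - x → Within c x
    by-gap-within {c} {x} 0≤e eq 0≤e′ eq′ =
      by-gap-≤ 0≤e (trans eq (solve 2 (λ c x → c :+ x := x :- (:- c)) refl c x)) , by-gap-≤ 0≤e′ eq′

    within-weaken : ∀ {c d x} → c ≤ d → Within c x → Within d x
    within-weaken {c} {d} {x} c≤d w = let l , u = within-gap w in by-gap-within
      (+-nonneg (gap-≤ c≤d) l) (solve 3 (λ c d x → (d :- c) :+ (c :+ x) := d :+ x) refl c d x)
      (+-nonneg (gap-≤ c≤d) u) (solve 3 (λ c d x → (d :- c) :+ (c :- x) := d :- x) refl c d x)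

    within-+ : ∀ {c d x y} → Within c x → Within d y → Within (c + d) (x + y)
    within-+ {c} {d} {x} {y} w w′ = let l , u = within-gap w; l′ , u′ = within-gap w′ in by-gap-within
      (+-nonneg l l′) (solve 4 (λ c d x y → (c :+ x) :+ (d :+ y) := (c :+ d) :+ (x :+ y)) refl c d x y)
      (+-nonneg u u′) (solve 4 (λ c d x y → (c :- x) :+ (d :- y) := (c :+ d) :- (x :+ y)) refl c d x y)

    within-neg : ∀ {c x} → Within c x → Within c (- x)
    within-neg {c} {x} w = let l , u = within-gap w in
      by-gap-within u refl l (solve 2 (λ c x → c :+ x := c :- (:- x)) refl c x)

    -- (c ± x)(d ± y) summed over the two sign patterns of equal (opposite) signs
    -- is 2(cd ± xy).
    within-* : ∀ {c d x y} → Within c x → Within d y → Within (c * d) (x * y)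
    within-* {c} {d} {x} {y} w w′ = let l , u = within-gap w; l′ , u′ = within-gap w′ in by-gap-within
      (halve-nonneg (subst (0# ≤_)
        (solve 4 (λ c d x y → (c :+ x) :* (d :+ y) :+ (c :- x) :* (d :- y)
                            := (c :* d :+ x :* y) :+ (c :* d :+ x :* y)) refl c d x y)
        (+-nonneg (*-nonneg l l′) (*-nonneg u u′)))) refl
      (halve-nonneg (subst (0# ≤_)
        (solve 4 (λ c d x y → (c :- x) :* (d :+ y) :+ (c :+ x) :* (d :- y)
                            := (c :* d :- x :* y) :+ (c :* d :- x :* y)) refl c d x y)
        (+-nonneg (*-nonneg u l′) (*-nonneg l u′)))) refl

    within-square : ∀ {c x} → Within c x → x * x ≤ c * c
    within-square w = proj₂ (within-* w w)

    square-within : ∀ {c x} → 0# ≤ c → x * x ≤ c * c → Within c x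
    square-within {c} {x} 0≤c x²≤c² = by-gap-≤ (gap-≤ (square-cancel-≤ 0≤c
        (subst (_≤ c * c) (solve 1 (λ x → x :* x := (:- x) :* (:- x)) refl x) x²≤c²)))
        (solve 2 (λ c x → c :- (:- x) := x :- (:- c)) refl c x)
      , square-cancel-≤ 0≤c x²≤c²

-- The Archimedean property and integer parts.

module Archimedean (em : ExcludedMiddle 0ℓ) (R : CompleteOrderedField) where

  open OrderedField R

  opaque
    -- Otherwise the natural numbers have a supremum s. Since n + 1 is at most s for every n,
    -- already s - 1 is an upper bound, a contradiction.
    archimedean : ∀ x → ∃ λ n → x < ν n
    archimedean x with em {∃ λ n → x < ν n}
    ... | yes found = found
    ... | no none with complete (λ y → ∃ λ n → y ≡ ν n) (0# , 0 , refl) (x , bound)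
      where
      bound : ∀ y → (∃ λ n → y ≡ ν n) → y ≤ x
      bound _ (n , refl) with ≤-<-connex (ν n) x
      ... | inj₁ n≤x = n≤x
      ... | inj₂ x<n = ⊥-elim (none (n , x<n))
    ... | s , upper , least = ⊥-elim (≤⇒≯ (least (s - 1#) upper′)
          (by-gap-< 0<1 (solve 1 (λ s → con 1ℤ := s :- (s :- con 1ℤ)) refl s)))
      where
      upper′ : ∀ y → (∃ λ n → y ≡ ν n) → y ≤ s - 1#
      upper′ _ (n , refl) = by-gap-≤ (gap-≤ (upper (ν (suc n)) (suc n , refl))) (trans
        (cong (λ z → s - z) (ν-suc n))
        (solve 2 (λ s a → s :- (con 1ℤ :+ a) := (s :- con 1ℤ) :- a) refl s (ν n)))

  -- Searches downwards from a strict upper bound; the first natural number not above `x` is the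
  -- integer part.
  natural-floor : ∀ {x} n → 0# ≤ x → x < ν n → ∃ λ k → ν k ≤ x × x < ν k + 1#
  natural-floor     zero    0≤x x<0 = ⊥-elim (≤⇒≯ 0≤x x<0)
  natural-floor {x} (suc n) 0≤x x<1+n with ≤-<-connex (ν n) x
  ... | inj₁ n≤x = n , n≤x , subst (x <_) (trans (ν-suc n) (+-comm _ _)) x<1+n
  ... | inj₂ x<n = natural-floor n 0≤x x<n

  opaque
    floor : ∀ x → ∃ λ i → ι i ≤ x × x < ι i + 1#
    floor x =
      -- Translation by `m` makes the argument positive, so the search among natural numbers
      -- applies; `m` is subtracted again at the end.
      let m , -x<m  = archimedean (- x)
          n , x+m<n = archimedean (x + ν m)
          0≤x+m     = inj₁ (subst (0# <_) (solve 2 (λ x m → m :- (:- x) := x :+ m) refl x (ν m)) (gap-< -x<m))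
          k , k≤x+m , x+m<k+1 = natural-floor n 0≤x+m x+m<n
      in k ⊖ m
       , subst (_≤ x) (sym (ι-⊖ k m)) (by-gap-≤ (gap-≤ k≤x+m)
           (solve 3 (λ x k m → (x :+ m) :- k := x :- (k :- m)) refl x (ν k) (ν m)))
       , subst (λ y → x < y + 1#) (sym (ι-⊖ k m)) (by-gap-< (gap-< x+m<k+1)
           (solve 3 (λ x k m → (k :+ con 1ℤ) :- (x :+ m) := ((k :- m) :+ con 1ℤ) :- x) refl x (ν k) (ν m)))

  opaque
    cell : ∀ {h} → 0# < h → ∀ x → ∃ (InCell h x)
    cell {h} 0<h x =
      let t , _ , ht≡1        = positive-inverse 0<h
          i , i≤xt , xt<i+1   = floor (x * t)
          xth≡x               = trans (solve 3 (λ x t h → x :* t :* h := x :* (h :* t)) refl x t h)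
                                  (trans (cong (x *_) ht≡1) (solve 1 (λ x → x :* con 1ℤ := x) refl x))
      in i , subst (ι i * h ≤_) xth≡x (*-monoˡ-≤ (inj₁ 0<h) i≤xt)
           , subst (_< (ι i + 1#) * h) xth≡x (*-monoˡ-< 0<h xt<i+1)

-- The plane as the complex numbers.

module Complex (R : CompleteOrderedField) where

  open OrderedField R public

  infixl 7 _⊛_
  infixl 6 _⊖²_
  infix  8 ⊝_

  1² : ℝ²
  1² = 1# , 0#

  ⊝_ : ℝ² → ℝ²
  ⊝ (x , y) = - x , - y

  _⊛_ : ℝ² → ℝ² → ℝ²
  (x , y) ⊛ (x′ , y′) = x * x′ - y * y′ , x * y′ + y * x′

  _⊖²_ : ℝ² → ℝ² → ℝ²
  z ⊖² w = z ⊕ (⊝ w)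

  opaque
    -- Makes the solver and the finite differences available for complex numbers.
    ℂ-isCommutativeRing : IsCommutativeRing _≡_ _⊕_ _⊛_ ⊝_ 0² 1²
    ℂ-isCommutativeRing = record
      { isRing = record
        { +-isAbelianGroup = record
          { isGroup = record
            { isMonoid = record
              { isSemigroup = record
                { isMagma = record { isEquivalence = isEquivalence ; ∙-cong = cong₂ _⊕_ }
                ; assoc   = λ _ _ _ → cong₂ _,_ (assoc-+ _ _ _) (assoc-+ _ _ _) }
              ; identity = (λ _ → cong₂ _,_ (0+ _) (0+ _)) , (λ _ → cong₂ _,_ (+0 _) (+0 _)) }
            ; inverse = (λ _ → cong₂ _,_ (-+ _) (-+ _)) , (λ _ → cong₂ _,_ (+- _) (+- _))
            ; ⁻¹-cong = cong ⊝_ }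
          ; comm = λ _ _ → cong₂ _,_ (+-comm _ _) (+-comm _ _) }
        ; *-cong = cong₂ _⊛_
        ; *-assoc = λ (a , b) (c , d) (x , y) → cong₂ _,_
            (solve 6 (λ a b c d x y → (a :* c :- b :* d) :* x :- (a :* d :+ b :* c) :* y
                                    := a :* (c :* x :- d :* y) :- b :* (c :* y :+ d :* x)) refl a b c d x y)
            (solve 6 (λ a b c d x y → (a :* c :- b :* d) :* y :+ (a :* d :+ b :* c) :* x
                                    := a :* (c :* y :+ d :* x) :+ b :* (c :* x :- d :* y)) refl a b c d x y)
        ; *-identity = (λ (x , y) → cong₂ _,_
              (solve 2 (λ x y → con 1ℤ :* x :- con 0ℤ :* y := x) refl x y)
              (solve 2 (λ x y → con 1ℤ :* y :+ con 0ℤ :* x := y) refl x y))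
            , (λ (x , y) → cong₂ _,_
              (solve 2 (λ x y → x :* con 1ℤ :- y :* con 0ℤ := x) refl x y)
              (solve 2 (λ x y → x :* con 0ℤ :+ y :* con 1ℤ := y) refl x y))
        ; distrib = (λ (a , b) (c , d) (x , y) → cong₂ _,_
              (solve 6 (λ a b c d x y → a :* (c :+ x) :- b :* (d :+ y)
                                      := (a :* c :- b :* d) :+ (a :* x :- b :* y)) refl a b c d x y)
              (solve 6 (λ a b c d x y → a :* (d :+ y) :+ b :* (c :+ x)
                                      := (a :* d :+ b :* c) :+ (a :* y :+ b :* x)) refl a b c d x y))
            , (λ (a , b) (c , d) (x , y) → cong₂ _,_
              (solve 6 (λ a b c d x y → (c :+ x) :* a :- (d :+ y) :* b
                                      := (c :* a :- d :* b) :+ (x :* a :- y :* b)) refl a b c d x y)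
              (solve 6 (λ a b c d x y → (c :+ x) :* b :+ (d :+ y) :* a
                                      := (c :* b :+ d :* a) :+ (x :* b :+ y :* a)) refl a b c d x y))
        }
      ; *-comm = λ (x , y) (x′ , y′) → cong₂ _,_
          (solve 4 (λ x y a b → x :* a :- y :* b := a :* x :- b :* y) refl x y x′ y′)
          (solve 4 (λ x y a b → x :* b :+ y :* a := a :* y :+ b :* x) refl x y x′ y′)
      }
      where
      open IsCommutativeRing isCommutativeRing using ()
        renaming (+-assoc to assoc-+; +-identityˡ to 0+; +-identityʳ to +0; -‿inverseˡ to -+; -‿inverseʳ to +-)

  module ℂ where
    open IntegerScalars ℂ-isCommutativeRing public
    open FiniteDifferences ℂ-isCommutativeRing public

  ℂ-ν : ∀ n → ℂ.ν n ≡ (ν n , 0#)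
  ℂ-ν zero    = refl
  ℂ-ν (suc n) = trans (ℂ.ν-suc n) (trans (cong (1² ⊕_) (ℂ-ν n))
    (cong₂ _,_ (sym (ν-suc n)) (solve 0 (con 0ℤ :+ con 0ℤ := con 0ℤ) refl)))

  opaque
    -- Brahmagupta's two-square identity. Through it the modulus of a product of sides depends on
    -- their lengths only, not on their directions.
    normSq-⊛ : ∀ z w → normSq (z ⊛ w) ≡ normSq z * normSq w
    normSq-⊛ (x , y) (a , b) =
      solve 4 (λ x y a b → (x :* a :- y :* b) :* (x :* a :- y :* b) :+ (x :* b :+ y :* a) :* (x :* b :+ y :* a)
                         := (x :* x :+ y :* y) :* (a :* a :+ b :* b)) refl x y a b

    normSq-ν : ∀ n → normSq (ℂ.ν n) ≡ ν n * ν n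
    normSq-ν n = trans (cong normSq (ℂ-ν n))
      (solve 1 (λ x → x :* x :+ con 0ℤ :* con 0ℤ := x :* x) refl (ν n))

  -- Alternating sums over the vertices of a box.

  vertex-true : ∀ {n} z (u : Vector ℝ² (suc n)) r → vertex z u (true ∷ r) ≡ vertex (z ⊕ head u) (tail u) r
  vertex-true (x , y) u r = cong₂ _,_ (assoc x (proj₁ (head u))) (assoc y (proj₂ (head u)))
    where
    assoc : ∀ x u {v} → x + (1# * u + v) ≡ x + u + v
    assoc x u = solve 3 (λ x u v → x :+ (con 1ℤ :* u :+ v) := x :+ u :+ v) refl x u _

  vertex-false : ∀ {n} z (u : Vector ℝ² (suc n)) r → vertex z u (false ∷ r) ≡ vertex z (tail u) r
  vertex-false (x , y) u r = cong₂ _,_ (drop x (proj₁ (head u))) (drop y (proj₂ (head u)))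
    where
    drop : ∀ x u {v} → x + (0# * u + v) ≡ x + v
    drop x u = solve 3 (λ x u v → x :+ (con 0ℤ :* u :+ v) := x :+ v) refl x u _

  vertex-translate : ∀ {n} z w (u : Vector ℝ² n) r → vertex (z ⊕ w) u r ≡ vertex z u r ⊕ w
  vertex-translate (x , y) (a , b) u r = cong₂ _,_ (swap x a) (swap y b)
    where
    swap : ∀ x a {v} → x + a + v ≡ x + v + a
    swap x a = solve 3 (λ x a v → x :+ a :+ v := x :+ v :+ a) refl x a _

  -- Summing over the first bit replaces `f` by its difference along `head u`, which has degree one
  -- less, and leaves the box spanned by the other sides.
  alternatingSum-vertex : ∀ n {c f} → ℂ.HasLeading n c f → ∀ z u →
                          ℂ.alternatingSum n (f ∘ vertex z u) ≡ ℂ.boxVolume n c u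
  alternatingSum-vertex zero    h z u = h _
  alternatingSum-vertex (suc n) {c} {f} h z u = begin
    Alt (f ∘ vertex z u ∘ (true ∷_)) ⊖² Alt (f ∘ vertex z u ∘ (false ∷_))
      ≡⟨ cong₂ _⊖²_ (ℂ.alternatingSum-cong n (λ r → cong f (vertex-true z u r)))
                    (ℂ.alternatingSum-cong n (λ r → cong f (vertex-false z u r))) ⟩
    Alt (f ∘ vertex (z ⊕ head u) (tail u)) ⊖² Alt (f ∘ vertex z (tail u))
      ≡⟨ cong₂ _⊕_ (ℂ.alternatingSum-cong n (λ r → cong f (vertex-translate z (head u) (tail u) r)))
                   (sym (ℂ.alternatingSum-neg n _)) ⟩
    Alt (λ r → f (vertex z (tail u) r ⊕ head u)) ⊕ Alt (λ r → ⊝ f (vertex z (tail u) r))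
      ≡⟨ ℂ.alternatingSum-+ n _ _ ⟨
    Alt (ℂ.Δ (head u) f ∘ vertex z (tail u))
      ≡⟨ alternatingSum-vertex n (h (head u)) z (tail u) ⟩
    ℂ.boxVolume n (ℂ.ν (suc n) ⊛ (c ⊛ head u)) (tail u) ∎
    where
    open ≡-Reasoning
    Alt = ℂ.alternatingSum n

  -- `A` is a parameter because each difference multiplies the coefficient by `ν (suc n)` and a
  -- side. Comparing squares avoids square roots.
  normSq-boxVolume : ∀ n {c A} → normSq c ≡ A * A → (u : Vector ℝ² n) (a : Vector ℝ n) → (∀ k → HasLength (u k) (a k)) →
                     let V = A * ν (n !) * product a in normSq (ℂ.boxVolume n c u) ≡ V * V
  normSq-boxVolume zero    {c} {A} |c|≡A u a |u|≡a =
    trans |c|≡A (solve 1 (λ A → A :* A := (A :* con 1ℤ :* con 1ℤ) :* (A :* con 1ℤ :* con 1ℤ)) refl A)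
  normSq-boxVolume (suc n) {c} {A} |c|≡A u a |u|≡a = trans
    (normSq-boxVolume n {A = ν (suc n) * (A * head a)} head-step (tail u) (tail a) (|u|≡a ∘ Fin.suc))
    (cong (λ x → x * x) (trans
      (solve 5 (λ N A a F p → N :* (A :* a) :* F :* p := A :* (N :* F) :* (a :* p)) refl
         (ν (suc n)) A (head a) (ν (n !)) (product (tail a)))
      (cong (λ x → A * x * product a) (sym (ν-* (suc n) (n !))))))
    where
    open ≡-Reasoning
    head-step : normSq (ℂ.ν (suc n) ⊛ (c ⊛ head u)) ≡ (ν (suc n) * (A * head a)) * (ν (suc n) * (A * head a))
    head-step = begin
      normSq (ℂ.ν (suc n) ⊛ (c ⊛ head u))          ≡⟨ normSq-⊛ (ℂ.ν (suc n)) _ ⟩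
      normSq (ℂ.ν (suc n)) * normSq (c ⊛ head u)   ≡⟨ cong₂ _*_ (normSq-ν (suc n)) (normSq-⊛ c (head u)) ⟩
      ν (suc n) * ν (suc n) * (normSq c * normSq (head u))
        ≡⟨ cong (ν (suc n) * ν (suc n) *_) (cong₂ _*_ |c|≡A (sym (proj₂ (|u|≡a Fin.zero)))) ⟩
      ν (suc n) * ν (suc n) * (A * A * (head a * head a))
        ≡⟨ solve 3 (λ N A a → N :* N :* (A :* A :* (a :* a)) := (N :* (A :* a)) :* (N :* (A :* a))) refl (ν (suc n)) A (head a) ⟩
      (ν (suc n) * (A * head a)) * (ν (suc n) * (A * head a)) ∎

  -- Bounds in the maximum norm, and the growth of the monomial.

  Bounded : ℝ → ℝ² → Set
  Bounded c (x , y) = Within c x × Within c y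

  bounded-weaken : ∀ {c d z} → c ≤ d → Bounded c z → Bounded d z
  bounded-weaken c≤d (wx , wy) = within-weaken c≤d wx , within-weaken c≤d wy

  bounded-⊕ : ∀ {c d z w} → Bounded c z → Bounded d w → Bounded (c + d) (z ⊕ w)
  bounded-⊕ (wx , wy) (wx′ , wy′) = within-+ wx wx′ , within-+ wy wy′

  bounded-⊖² : ∀ {c d z w} → Bounded c z → Bounded d w → Bounded (c + d) (z ⊖² w)
  bounded-⊖² (wx , wy) (wx′ , wy′) = within-+ wx (within-neg wx′) , within-+ wy (within-neg wy′)

  -- The doubling arises because each coordinate of a complex product is a sum or difference of two
  -- real products.
  bounded-⊛ : ∀ {c d z w} → Bounded c z → Bounded d w → Bounded (c * d + c * d) (z ⊛ w)
  bounded-⊛ (wx , wy) (wx′ , wy′) =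
    within-+ (within-* wx wx′) (within-neg (within-* wy wy′)) , within-+ (within-* wx wy′) (within-* wy wx′)

  bounded-0² : ∀ {c} → 0# ≤ c → Bounded c 0²
  bounded-0² {c} 0≤c = within-0 , within-0
    where
    within-0 : Within c 0#
    within-0 = by-gap-within 0≤c (solve 1 (λ c → c := c :+ con 0ℤ) refl c) 0≤c (solve 1 (λ c → c := c :- con 0ℤ) refl c)

  -- The triangle inequality over the 2ⁿ vertices. The bound is kept a natural number, so that the
  -- final constants can be compared in ℕ.
  alternatingSum-bounded : ∀ n {φ e} → (∀ r → Bounded (ν e) (φ r)) → Bounded (ν (2 ^ n ℕ.* e)) (ℂ.alternatingSum n φ)
  alternatingSum-bounded zero    {φ} {e} h = subst (λ k → Bounded (ν k) (φ [])) (sym (ℕ.+-identityʳ e)) (h [])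
  alternatingSum-bounded (suc n) {φ} {e} h = subst (λ c → Bounded c (ℂ.alternatingSum (suc n) φ))
    (trans (sym (ν-+ (2 ^ n ℕ.* e) (2 ^ n ℕ.* e))) (cong ν (sym double)))
    (bounded-⊖² (alternatingSum-bounded n (h ∘ _)) (alternatingSum-bounded n (h ∘ _)))
    where
    double : 2 ^ suc n ℕ.* e ≡ 2 ^ n ℕ.* e ℕ.+ 2 ^ n ℕ.* e
    double = trans (cong (λ k → (2 ^ n ℕ.+ k) ℕ.* e) (ℕ.+-identityʳ (2 ^ n))) (ℕ.*-distribʳ-+ e (2 ^ n) (2 ^ n))

  monomial : ℕ → ℕ → ℝ² → ℝ²
  monomial K zero    z = ν K , 0#
  monomial K (suc n) z = z ⊛ monomial K n z

  monomial-leading : ∀ K n → ℂ.HasLeading n (ν K , 0#) (monomial K n)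
  monomial-leading K zero    z = refl
  monomial-leading K (suc n) = ℂ.HasLeading-z* n (monomial-leading K n)

  -- One constant serves both as a bound for the monomial on the square of half-side `B` and as a
  -- Lipschitz constant there. The factor 2(B + 1) leaves room for the two terms of the product
  -- rule, which cost 2B and 2.
  lipschitz : ℕ → ℕ → ℝ → ℝ
  lipschitz K zero    B = ν K
  lipschitz K (suc n) B = ((B + 1#) + (B + 1#)) * lipschitz K n B

  opaque
    -- Ensures that the inverse of this constant, later the mesh of a grid, exists and is at most 1.
    lipschitz-≥1 : ∀ K n {B} → 1 ℕ.≤ K → 0# ≤ B → 1# ≤ lipschitz K n B
    lipschitz-≥1 K zero    1≤K 0≤B = ν-mono-≤ 1≤K
    lipschitz-≥1 K (suc n) {B} 1≤K 0≤B = ≤-trans 1≤L (by-gap-≤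
      (*-nonneg (+-nonneg (+-nonneg 0≤B 0≤B) (inj₁ 0<1)) (≤-trans (inj₁ 0<1) 1≤L))
      (solve 2 (λ B L → (B :+ B :+ con 1ℤ) :* L := ((B :+ con 1ℤ) :+ (B :+ con 1ℤ)) :* L :- L) refl B (lipschitz K n B)))
      where
      1≤L : 1# ≤ lipschitz K n B
      1≤L = lipschitz-≥1 K n 1≤K 0≤B

    monomial-bounded : ∀ K n {B z} → 1 ℕ.≤ K → 0# ≤ B → Bounded B z → Bounded (lipschitz K n B) (monomial K n z)
    monomial-bounded K zero {B} 1≤K 0≤B bz = by-gap-within
        (+-nonneg (ν-nonneg K) (ν-nonneg K)) refl ≤-refl (solve 1 (λ a → con 0ℤ := a :- a) refl (ν K))
      , proj₁ (bounded-0² (ν-nonneg K))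
    monomial-bounded K (suc n) {B} {z} 1≤K 0≤B bz = bounded-weaken (by-gap-≤ (+-nonneg 0≤L 0≤L)
        (solve 2 (λ B L → L :+ L := ((B :+ con 1ℤ) :+ (B :+ con 1ℤ)) :* L :- (B :* L :+ B :* L)) refl B (lipschitz K n B)))
      (bounded-⊛ {z = z} bz (monomial-bounded K n 1≤K 0≤B bz))
      where
      0≤L : 0# ≤ lipschitz K n B
      0≤L = ≤-trans (inj₁ 0<1) (lipschitz-≥1 K n 1≤K 0≤B)

    -- Induction by zf(z) - wf(w) = z(f(z) - f(w)) + (z - w)f(w), where f is the monomial of lower
    -- degree.
    monomial-lipschitz : ∀ K n {B d z w} → 1 ℕ.≤ K → 0# ≤ B → 0# ≤ d → Bounded B z → Bounded B w → Bounded d (z ⊖² w) →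
                         Bounded (lipschitz K n B * d) (monomial K n z ⊖² monomial K n w)
    monomial-lipschitz K zero {B} {d} 1≤K 0≤B 0≤d bz bw bzw = subst (Bounded (ν K * d))
      (ℂ.solve 1 (λ a → ℂ.con 0ℤ ℂ.:= a ℂ.:- a) refl _) (bounded-0² (*-nonneg (ν-nonneg K) 0≤d))
    monomial-lipschitz K (suc n) {B} {d} {z} {w} 1≤K 0≤B 0≤d bz bw bzw = subst₂ Bounded
      (solve 3 (λ B L d → (B :* (L :* d) :+ B :* (L :* d)) :+ (d :* L :+ d :* L)
                        := ((B :+ con 1ℤ) :+ (B :+ con 1ℤ)) :* L :* d) refl B (lipschitz K n B) d)
      (ℂ.solve 4 (λ z w f g → z ℂ.:* (f ℂ.:- g) ℂ.:+ (z ℂ.:- w) ℂ.:* g ℂ.:= z ℂ.:* f ℂ.:- w ℂ.:* g) refl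
         z w (monomial K n z) (monomial K n w))
      (bounded-⊕ (bounded-⊛ {z = z} bz (monomial-lipschitz K n 1≤K 0≤B 0≤d bz bw bzw))
                 (bounded-⊛ {z = z ⊖² w} bzw (monomial-bounded K n 1≤K 0≤B bw)))

-- Countable sets.

Enumerable : Set → Set
Enumerable A = Σ (ℕ → A) (StrictlySurjective _≡_)

-- Cantor's walk along the antidiagonals, each traversed from (s, 0) to (0, s).
diagonal : ℕ → ℕ × ℕ
diagonal zero    = 0 , 0
diagonal (suc n) with diagonal n
... | zero  , b = suc b , 0
... | suc a , b = a , suc b

diagonal-surjective : StrictlySurjective _≡_ diagonal
diagonal-surjective (a , b) =
  along b a (start (b ℕ.+ a))
  where
  along : ∀ b a → ∃ (λ n → diagonal n ≡ (b ℕ.+ a , 0)) → ∃ λ n → diagonal n ≡ (a , b)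
  along zero    a found = found
  along (suc b) a found with along b (suc a) (subst (λ s → ∃ λ n → diagonal n ≡ (s , 0)) (sym (ℕ.+-suc b a)) found)
  ... | n , eq = suc n , step
    where
    step : diagonal (suc n) ≡ (a , suc b)
    step rewrite eq = refl

  start : ∀ s → ∃ λ n → diagonal n ≡ (s , 0)
  start zero    = 0 , refl
  -- The antidiagonal of sum `s` ends at (0, s); one more step of the walk opens the next.
  start (suc s) with along s 0 (subst (λ s → ∃ λ n → diagonal n ≡ (s , 0)) (sym (ℕ.+-identityʳ s)) (start s))
  ... | n , eq = suc n , step
    where
    step : diagonal (suc n) ≡ (suc s , 0)
    step rewrite eq = refl

ℕ-enumerable : Enumerable ℕ
ℕ-enumerable = (λ n → n) , λ n → n , refl

×-enumerable : ∀ {A B} → Enumerable A → Enumerable B → Enumerable (A × B)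
×-enumerable (e , e-onto) (f , f-onto) = (λ n → e (proj₁ (diagonal n)) , f (proj₂ (diagonal n))) , onto
  where
  onto : StrictlySurjective _≡_ _
  onto (a , b) with e-onto a | f-onto b
  ... | i , refl | j , refl with diagonal-surjective (i , j)
  ...   | n , eq = n , cong (λ (i , j) → e i , f j) eq

image-enumerable : ∀ {A B} {f : A → B} → StrictlySurjective _≡_ f → Enumerable A → Enumerable B
image-enumerable {f = f} f-onto (e , e-onto) = f ∘ e , λ b →
  let a , fa≡b = f-onto b; n , en≡a = e-onto a in n , trans (cong f en≡a) fa≡b

ℤ-enumerable : Enumerable ℤ
ℤ-enumerable = image-enumerable {f = λ (m , n) → m ⊖ n} onto (×-enumerable ℕ-enumerable ℕ-enumerable)
  where
  onto : StrictlySurjective _≡_ _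
  onto (ℤ.+ n)  = (n , 0) , refl
  onto -[1+ n ] = (0 , suc n) , refl

Maybe-enumerable : ∀ {A} → Enumerable A → Enumerable (Maybe A)
Maybe-enumerable {A} (e , e-onto) = f , onto
  where
  f : ℕ → Maybe A
  f zero    = nothing
  f (suc n) = just (e n)
  onto : StrictlySurjective _≡_ f
  onto nothing  = 0 , refl
  onto (just a) = let n , eq = e-onto a in suc n , cong just eq

Bool-enumerable : Enumerable Bool
Bool-enumerable = image-enumerable {f = λ { zero → false ; (suc _) → true }} onto ℕ-enumerable
  where
  onto : StrictlySurjective _≡_ _
  onto false = 0 , refl
  onto true  = 1 , refl

-- Null sets from covers by degenerate rectangles.

module NullSets (em : ExcludedMiddle 0ℓ) (R : CompleteOrderedField) where

  open Complex R
  open Archimedean em R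

  partialSum-zero : ∀ {f} → (∀ k → f k ≡ 0#) → ∀ N → partialSum f N ≡ 0#
  partialSum-zero f≡0 zero    = refl
  partialSum-zero f≡0 (suc N) = trans (cong₂ _+_ (partialSum-zero f≡0 N) (f≡0 N))
    (solve 0 (con 0ℤ :+ con 0ℤ := con 0ℤ) refl)

  null-by-zero-areas : ∀ {A} (Q : ℕ → Rectangle) → (∀ k → area (Q k) ≡ 0#) →
                       (∀ z → z ∈ A → ∃ λ k → z ∈ Contains (Q k)) → LebesgueNull A
  null-by-zero-areas Q area≡0 covers =
      -- The empty partial sum already shows that every total area is at least 0.
      (λ { s (_ , _ , upper , _) → upper 0# (0 , refl) })
    , (λ b lower → lower 0# (Q , covers , sum-zero , λ b upper → upper 0# (0 , refl)))
    where
    sum-zero : ∀ x → (∃ λ N → x ≡ partialSum (area ∘ Q) N) → x ≤ 0#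
    sum-zero _ (N , eq) = inj₂ (trans eq (partialSum-zero area≡0 N))

  -- `false` selects the vertical line through `q` and `true` the horizontal one; `m` cuts off the
  -- part between -m and m.
  segment : (Bool × ℝ) × ℕ → Rectangle
  segment ((false , q) , m) = record
    { left = q ; right = q ; bottom = - ν m ; top = ν m ; left≤right = ≤-refl
    ; bottom≤top = by-gap-≤ (+-nonneg (ν-nonneg m) (ν-nonneg m)) (solve 1 (λ a → a :+ a := a :- (:- a)) refl (ν m)) }
  segment ((true , q) , m) = record
    { left = - ν m ; right = ν m ; bottom = q ; top = q ; bottom≤top = ≤-refl
    ; left≤right = by-gap-≤ (+-nonneg (ν-nonneg m) (ν-nonneg m)) (solve 1 (λ a → a :+ a := a :- (:- a)) refl (ν m)) }

  segment-area : ∀ l → area (segment l) ≡ 0#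
  segment-area ((false , q) , m) = solve 2 (λ q m → (q :- q) :* (m :- (:- m)) := con 0ℤ) refl q (ν m)
  segment-area ((true  , q) , m) = solve 2 (λ q m → (m :- (:- m)) :* (q :- q) := con 0ℤ) refl q (ν m)

  bounded-by-ν : ∀ x → ∃ λ m → Within (ν m) x
  bounded-by-ν x =
    let m , x<m = archimedean x
        n , -x<n = archimedean (- x)
    in m ℕ.+ n
     , by-gap-≤ (+-nonneg (inj₁ (gap-< -x<n)) (ν-nonneg m)) (trans
         (solve 3 (λ x a b → (b :- (:- x)) :+ a := x :- (:- (a :+ b))) refl x (ν m) (ν n))
         (cong (λ y → x - (- y)) (sym (ν-+ m n))))
     , by-gap-≤ (+-nonneg (inj₁ (gap-< x<m)) (ν-nonneg n)) (trans
         (solve 3 (λ x a b → (a :- x) :+ b := (a :+ b) :- x) refl x (ν m) (ν n))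
         (cong (_- x) (sym (ν-+ m n))))

  -- A countable union of horizontal and vertical lines is null, since a line is
  -- a countable union of segments, which are rectangles of area 0.
  null-by-lines : ∀ {A I} {q : I → ℝ} → Enumerable I →
                  (∀ {x y} → (x , y) ∈ A → ∃ λ i → x ≡ q i ⊎ y ≡ q i) → LebesgueNull A
  null-by-lines {A} {I} {q} I-enum on-line =
    null-by-zero-areas (segment ∘ place ∘ e) (segment-area ∘ place ∘ e) covers
    where
    place : (Bool × I) × ℕ → (Bool × ℝ) × ℕ
    place ((b , i) , m) = (b , q i) , m
    enum : Enumerable ((Bool × I) × ℕ)
    enum = ×-enumerable (×-enumerable Bool-enumerable I-enum) ℕ-enumerable
    e = proj₁ enum
    found : ∀ {z} l → z ∈ Contains (segment (place l)) → ∃ λ k → z ∈ Contains (segment (place (e k)))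
    found {z} l z∈l = let k , eq = proj₂ enum l in k , subst (λ l → z ∈ Contains (segment (place l))) (sym eq) z∈l
    covers : ∀ z → z ∈ A → ∃ λ k → z ∈ Contains (segment (place (e k)))
    covers (x , y) z∈A with on-line z∈A
    ... | i , inj₁ refl = let m , y-bounded = bounded-by-ν y in
                          found ((false , i) , m) ((≤-refl , ≤-refl) , y-bounded)
    ... | i , inj₂ refl = let m , x-bounded = bounded-by-ν x in
                          found ((true , i) , m) (x-bounded , (≤-refl , ≤-refl))

  -- Neighbourhoods on the line and in the plane.

  Near : ℝ → ℝ → ℝ → Set
  Near ε x x′ = 0# < (x′ - x) + ε × 0# < ε - (x′ - x)

  opaque
    square-cancel-< : ∀ {ε d} → 0# < ε → d * d < ε * ε → d < ε
    square-cancel-< {ε} {d} 0<ε d²<ε² with ≤-<-connex ε d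
    ... | inj₂ d<ε = d<ε
    ... | inj₁ ε≤d = ⊥-elim (≤⇒≯ (by-gap-≤ (*-nonneg (gap-≤ ε≤d) (+-nonneg (inj₁ 0<ε) (≤-trans (inj₁ 0<ε) ε≤d)))
          (solve 2 (λ ε d → (d :- ε) :* (ε :+ d) := d :* d :- ε :* ε) refl ε d)) d²<ε²)

    near-square : ∀ {ε x x′} → 0# < ε → (x′ - x) * (x′ - x) < ε * ε → Near ε x x′
    near-square {ε} {x} {x′} 0<ε d²<ε² =
        subst (0# <_) (solve 2 (λ ε d → ε :- (:- d) := d :+ ε) refl ε (x′ - x))
          (gap-< (square-cancel-< 0<ε (subst (_< ε * ε)
            (solve 1 (λ d → d :* d := (:- d) :* (:- d)) refl (x′ - x)) d²<ε²)))
      , gap-< (square-cancel-< 0<ε d²<ε²)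

    -- Each squared coordinate is at most the squared norm, so a ball lies in a square and the two
    -- coordinates can be treated separately.
    ball-near : ∀ {ε x y x′ y′} → 0# < ε → (x′ , y′) ∈ Ball (x , y) ε → Near ε x x′ × Near ε y y′
    ball-near {ε} {x} {y} {x′} {y′} 0<ε w∈ball =
        near-square 0<ε (≤-<-trans (by-gap-≤ (square-nonneg (y′ - y))
          (solve 2 (λ a b → b :* b := (a :* a :+ b :* b) :- a :* a) refl (x′ - x) (y′ - y))) w∈ball)
      , near-square 0<ε (≤-<-trans (by-gap-≤ (square-nonneg (x′ - x))
          (solve 2 (λ a b → a :* a := (a :* a :+ b :* b) :- b :* b) refl (x′ - x) (y′ - y))) w∈ball)

    near-weaken : ∀ {ε δ x x′} → ε ≤ δ → Near ε x x′ → Near δ x x′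
    near-weaken {ε} {δ} {x} {x′} ε≤δ (l , u) =
        subst (0# <_) (solve 3 (λ d ε δ → (d :+ ε) :+ (δ :- ε) := d :+ δ) refl (x′ - x) ε δ) (+-pos l (gap-≤ ε≤δ))
      , subst (0# <_) (solve 3 (λ d ε δ → (ε :- d) :+ (δ :- ε) := δ :- d) refl (x′ - x) ε δ) (+-pos u (gap-≤ ε≤δ))

  Eventually : ℝ → Pred ℝ 0ℓ → Set
  Eventually x P = ∃ λ ε → 0# < ε × (∀ x′ → Near ε x x′ → P x′)

  eventually-∩ : ∀ {x P Q} → Eventually x P → Eventually x Q → Eventually x (λ x′ → P x′ × Q x′)
  eventually-∩ (ε , 0<ε , p) (δ , 0<δ , q) with ≤-<-connex ε δ
  ... | inj₁ ε≤δ = ε , 0<ε , λ x′ near → p x′ near , q x′ (near-weaken ε≤δ near)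
  ... | inj₂ δ<ε = δ , 0<δ , λ x′ near → p x′ (near-weaken (inj₁ δ<ε) near) , q x′ near

  eventually-> : ∀ {c x} → c < x → Eventually x (c <_)
  eventually-> {c} {x} c<x = x - c , gap-< c<x , λ x′ near → by-gap-< (proj₁ near)
    (solve 3 (λ x c x′ → (x′ :- x) :+ (x :- c) := x′ :- c) refl x c x′)

  eventually-< : ∀ {c x} → x < c → Eventually x (_< c)
  eventually-< {c} {x} x<c = c - x , gap-< x<c , λ x′ near → by-gap-< (proj₂ near)
    (solve 3 (λ x c x′ → (c :- x) :- (x′ :- x) := c :- x′) refl x c x′)

  -- Of the two ends of a half-open cell, only the left one belongs to it and has to be excluded.
  eventually-InCell : ∀ {h x} i → InCell h x i → x ≢ ι i * h → Eventually x (λ x′ → InCell h x′ i)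
  eventually-InCell i (inj₂ ih≡x , _) x≢ih = ⊥-elim (x≢ih (sym ih≡x))
  eventually-InCell i (inj₁ ih<x , x<) x≢ih =
    let ε , 0<ε , p = eventually-∩ (eventually-> ih<x) (eventually-< x<)
    in ε , 0<ε , λ x′ near → inj₁ (proj₁ (p x′ near)) , proj₂ (p x′ near)

-- The grids and the rounding of points to them.

module Colouring (em : ExcludedMiddle 0ℓ) (R : CompleteOrderedField)
                 (K n M : ℕ) (1≤K : 1 ℕ.≤ K) {{M≢0 : NonZero M}} where

  open Complex R
  open Archimedean em R
  open NullSets em R

  f : ℝ² → ℝ²
  f = monomial K n

  -- One unit allows for the position of a point in its unit cell, the other for rounding to the
  -- finer grid, whose mesh is at most 1.
  margin : ℤ → ℝ
  margin a = ν ∣ a ∣ + 1# + 1#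

  margin-nonneg : ∀ a → 0# ≤ margin a
  margin-nonneg a = +-nonneg (+-nonneg (ν-nonneg ∣ a ∣) (inj₁ 0<1)) (inj₁ 0<1)

  -- The sum dominates both margins and replaces their maximum.
  radius : ℤ × ℤ → ℝ
  radius (a , b) = margin a + margin b

  radius-nonneg : ∀ s → 0# ≤ radius s
  radius-nonneg (a , b) = +-nonneg (margin-nonneg a) (margin-nonneg b)

  slope : ℤ × ℤ → ℝ
  slope s = lipschitz K n (radius s)

  slope-≥1 : ∀ s → 1# ≤ slope s
  slope-≥1 s = lipschitz-≥1 K n 1≤K (radius-nonneg s)

  slope⁻¹ : ∀ s → ∃ λ h → 0# < h × slope s * h ≡ 1#
  slope⁻¹ s = positive-inverse (<-≤-trans 0<1 (slope-≥1 s))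

  -- The unit grid (nothing), and the finer grid used inside its square s (just s).
  step : Maybe (ℤ × ℤ) → ℝ
  step nothing  = 1#
  step (just s) = proj₁ (slope⁻¹ s)

  step-pos : ∀ s → 0# < step s
  step-pos nothing  = 0<1
  step-pos (just s) = proj₁ (proj₂ (slope⁻¹ s))

  step-≤1 : ∀ s → step (just s) ≤ 1#
  step-≤1 s = by-gap-≤ (*-nonneg (gap-≤ (slope-≥1 s)) (inj₁ (step-pos (just s)))) (trans
    (solve 2 (λ L h → (L :- con 1ℤ) :* h := L :* h :- h) refl (slope s) (step (just s)))
    (cong (_- step (just s)) (proj₂ (proj₂ (slope⁻¹ s)))))

  index : Maybe (ℤ × ℤ) → ℝ → ℤ
  index s x = proj₁ (cell (step-pos s) x)

  index-InCell : ∀ s x → InCell (step s) x (index s x)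
  index-InCell s x = proj₂ (cell (step-pos s) x)

  square : ℝ² → ℤ × ℤ
  square (x , y) = index nothing x , index nothing y

  cornerIn : Maybe (ℤ × ℤ) → ℝ² → ℝ²
  cornerIn s (x , y) = ι (index s x) * step s , ι (index s y) * step s

  corner : ℝ² → ℝ²
  corner z = cornerIn (just (square z)) z

  InCell-within : ∀ {h x} i → 0# ≤ h → InCell h x i → Within h (x - ι i * h)
  InCell-within {h} {x} i 0≤h (ih≤x , x<) = by-gap-within
    (+-nonneg 0≤h (gap-≤ ih≤x)) refl
    (inj₁ (gap-< x<)) (solve 3 (λ h x i → (i :+ con 1ℤ) :* h :- x := h :- (x :- i :* h)) refl h x (ι i))

  ι-within : ∀ i → Within (ν ∣ i ∣) (ι i)
  ι-within (ℤ.+ n)  = by-gap-within (+-nonneg (ν-nonneg n) (ν-nonneg n)) refl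
                        ≤-refl (solve 1 (λ a → con 0ℤ := a :- a) refl (ν n))
  ι-within -[1+ n ] = within-neg (ι-within (ℤ.+ suc n))

  coordinate-within : ∀ x → Within (ν ∣ index nothing x ∣ + 1#) x
  coordinate-within x = subst (Within _)
    (solve 2 (λ x i → i :+ (x :- i :* con 1ℤ) := x) refl x (ι (index nothing x)))
    (within-+ (ι-within (index nothing x)) (InCell-within (index nothing x) (inj₁ 0<1) (index-InCell nothing x)))

  rounding-error : ∀ s x → Within (step s) (x - ι (index s x) * step s)
  rounding-error s x = InCell-within (index s x) (inj₁ (step-pos s)) (index-InCell s x)

  -- The finer mesh need not divide 1, so the rounded point may leave the unit cell of `x`; it stays
  -- within one mesh of `x`.
  rounded-within : ∀ s x → Within (margin (index nothing x)) (ι (index (just s) x) * step (just s))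
  rounded-within s x = subst (Within _)
    (solve 2 (λ x c → x :- (x :- c) := c) refl x (ι (index (just s) x) * step (just s)))
    (within-+ (coordinate-within x) (within-neg (within-weaken (step-≤1 s) (rounding-error (just s) x))))

  margins-bound : ∀ {a b x y} → Within (margin a) x → Within (margin b) y → Bounded (radius (a , b)) (x , y)
  margins-bound {a} {b} wx wy =
      within-weaken (by-gap-≤ (margin-nonneg b) (solve 2 (λ a b → b := (a :+ b) :- a) refl (margin a) (margin b))) wx
    , within-weaken (by-gap-≤ (margin-nonneg a) (solve 2 (λ a b → a := (a :+ b) :- b) refl (margin a) (margin b))) wy

  z-bounded : ∀ z → Bounded (radius (square z)) z
  z-bounded (x , y) = margins-bound {index nothing x} {index nothing y}
                        (within-margin (index nothing x) (coordinate-within x))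
                        (within-margin (index nothing y) (coordinate-within y))
    where
    within-margin : ∀ a {x} → Within (ν ∣ a ∣ + 1#) x → Within (margin a) x
    within-margin a = within-weaken (by-gap-≤ (inj₁ 0<1) (solve 1 (λ a → con 1ℤ := (a :+ con 1ℤ) :- a) refl (ν ∣ a ∣ + 1#)))

  corner-bounded : ∀ z → Bounded (radius (square z)) (corner z)
  corner-bounded z@(x , y) = margins-bound {index nothing x} {index nothing y}
                               (rounded-within (square z) x) (rounded-within (square z) y)

  -- Both points lie in the square on which `slope` is a Lipschitz constant, and they differ by at
  -- most its inverse in each coordinate.
  f-corner-error : ∀ z → Bounded 1# (f z ⊖² f (corner z))
  f-corner-error z = subst (λ c → Bounded c (f z ⊖² f (corner z))) (proj₂ (proj₂ (slope⁻¹ (square z))))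
    (monomial-lipschitz K n 1≤K (radius-nonneg (square z)) (inj₁ (step-pos (just (square z))))
      (z-bounded z) (corner-bounded z) (rounding-error (just (square z)) (proj₁ z) , rounding-error (just (square z)) (proj₂ z)))

  -- Local constancy off the grid lines.

  gridLine : Maybe (ℤ × ℤ) × ℤ → ℝ
  gridLine (s , i) = ι i * step s

  -- Every line of every grid counts along its whole length, even outside the unit square that uses
  -- the grid. The lines remain countably many.
  OnGrid : Pred ℝ² 0ℓ
  OnGrid (x , y) = ∃ λ l → x ≡ gridLine l ⊎ y ≡ gridLine l

  -- Off the lines, `z` is interior to its unit square and to its cell of the finer grid, so nearby
  -- points share both.
  corner-locally-constant : ∀ z → ¬ OnGrid z → ∃ λ ε → 0# < ε × (∀ w → w ∈ Ball z ε → corner w ≡ corner z)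
  corner-locally-constant z@(x , y) off =
    let ε , 0<ε , near-x = stable x (λ l eq → off (l , inj₁ eq))
        δ , 0<δ , near-y = stable y (λ l eq → off (l , inj₂ eq))
    in shrink ε 0<ε near-x δ 0<δ near-y
    where
    s = just (square z)

    Stable : ℝ → ℝ → Set
    Stable x x′ = index nothing x′ ≡ index nothing x × index s x′ ≡ index s x

    stable : ∀ x → (∀ l → x ≢ gridLine l) → Eventually x (Stable x)
    stable x off =
      let ε , 0<ε , near = eventually-∩ (eventually-InCell (index nothing x) (index-InCell nothing x) (off (nothing , index nothing x)))
                                        (eventually-InCell (index s x) (index-InCell s x) (off (s , index s x)))
      in ε , 0<ε , λ x′ x′-near →
           InCell-unique (index nothing x′) (index nothing x) 0<1 (index-InCell nothing x′) (proj₁ (near x′ x′-near))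
         , InCell-unique (index s x′) (index s x) (step-pos s) (index-InCell s x′) (proj₂ (near x′ x′-near))

    corner-stable : ∀ x′ y′ → Stable x x′ → Stable y y′ → corner (x′ , y′) ≡ corner (x , y)
    corner-stable x′ y′ (a≡ , i≡) (b≡ , j≡) = trans
      -- A nearby point has the same unit square, hence the same finer grid; only then can its cell
      -- be compared with that of `z`.
      (cong (λ s → cornerIn (just s) (x′ , y′)) (cong₂ _,_ a≡ b≡))
      (cong₂ (λ i j → ι i * step s , ι j * step s) i≡ j≡)

    shrink : ∀ ε → 0# < ε → (∀ x′ → Near ε x x′ → Stable x x′) →
             ∀ δ → 0# < δ → (∀ y′ → Near δ y y′ → Stable y y′) →
             ∃ λ ε → 0# < ε × (∀ w → w ∈ Ball z ε → corner w ≡ corner z)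
    shrink ε 0<ε near-x δ 0<δ near-y with ≤-<-connex ε δ
    ... | inj₁ ε≤δ = ε , 0<ε , λ (x′ , y′) w∈ball → let nx , ny = ball-near 0<ε w∈ball in
                       corner-stable x′ y′ (near-x x′ nx) (near-y y′ (near-weaken ε≤δ ny))
    ... | inj₂ δ<ε = δ , 0<δ , λ (x′ , y′) w∈ball → let nx , ny = ball-near 0<δ w∈ball in
                       corner-stable x′ y′ (near-x x′ (near-weaken (inj₁ δ<ε) nx)) (near-y y′ ny)

  -- Residues modulo `M` and the colour classes.

  residue : ℝ → Fin M
  residue x = fromℕ< (n%ℕd<d (proj₁ (floor x)) M)

  -- The quotient `k` will be a lattice coordinate, and the fractional part of `x` is the error.
  residue-spec : ∀ x → ∃ λ k → Within 1# (x - (ι k * ν M + ν (toℕ (residue x))))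
  residue-spec x = k , subst (λ y → Within 1# (x - y)) floor≡
      (by-gap-within (+-nonneg (inj₁ 0<1) (gap-≤ i≤x)) refl
        (inj₁ (gap-< x<i+1)) (solve 2 (λ x i → (i :+ con 1ℤ) :- x := con 1ℤ :- (x :- i)) refl x (ι i)))
    where
    i = proj₁ (floor x)
    k = i /ℕ M
    i≤x : ι i ≤ x
    i≤x = proj₁ (proj₂ (floor x))
    x<i+1 : x < ι i + 1#
    x<i+1 = proj₂ (proj₂ (floor x))
    open ≡-Reasoning
    floor≡ : ι i ≡ ι k * ν M + ν (toℕ (residue x))
    floor≡ = begin
      ι i                                  ≡⟨ cong ι (a≡a%ℕn+[a/ℕn]*n i M) ⟩
      ι (ℤ.+ (i %ℕ M) ℤ.+ k ℤ.* ℤ.+ M)     ≡⟨ ι-+ (ℤ.+ (i %ℕ M)) (k ℤ.* ℤ.+ M) ⟩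
      ν (i %ℕ M) + ι (k ℤ.* ℤ.+ M)         ≡⟨ +-comm _ _ ⟩
      ι (k ℤ.* ℤ.+ M) + ν (i %ℕ M)         ≡⟨ cong₂ (λ u v → u + ν v) (ι-* k (ℤ.+ M)) (sym (Fin.toℕ-fromℕ< (n%ℕd<d i M))) ⟩
      ι k * ν M + ν (toℕ (residue x))      ∎

  colour : ℝ² → Fin (M ℕ.* M)
  colour z = let x , y = f (corner z) in combine (residue x) (residue y)

  -- Reads the residues off the colour alone, so that they are visibly constant on a class.
  colourResidue : Fin (M ℕ.* M) → ℝ²
  colourResidue c = let i , j = remQuot {M} M c in ν (toℕ i) , ν (toℕ j)

  Lattice : Pred ℝ² 0ℓ
  Lattice w = ∃ λ i → ∃ λ j → w ≡ (ι i * ν M , ι j * ν M)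

  lattice-⊖² : ∀ {w w′} → Lattice w → Lattice w′ → Lattice (w ⊖² w′)
  lattice-⊖² (i , j , refl) (i′ , j′ , refl) = i ℤ.- i′ , j ℤ.- j′ , cong₂ _,_ (sub i i′) (sub j j′)
    where
    sub : ∀ i i′ → ι i * ν M - ι i′ * ν M ≡ ι (i ℤ.- i′) * ν M
    sub i i′ = trans (solve 3 (λ i i′ m → i :* m :- i′ :* m := (i :- i′) :* m) refl (ι i) (ι i′) (ν M))
      (cong (_* ν M) (trans (cong (ι i +_) (sym (ι-neg i′))) (sym (ι-+ i (ℤ.- i′)))))

  -- Of the error 2 in each coordinate, one unit comes from moving `z` to its grid point and one
  -- from discarding fractional parts.
  f-decomposition : ∀ z → ∃ λ w → ∃ λ e → Lattice w × Bounded (ν 2) e × f z ≡ w ⊕ colourResidue (colour z) ⊕ e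
  f-decomposition z =
    let x , y   = f (corner z)
        i , wx  = residue-spec x
        j , wy  = residue-spec y
        w       = ι i * ν M , ι j * ν M
        r       = ν (toℕ (residue x)) , ν (toℕ (residue y))
        e       = (f z ⊖² f (corner z)) ⊕ (f (corner z) ⊖² (w ⊕ r))
    in w , e , (i , j , refl) , bounded-⊕ (f-corner-error z) (wx , wy) , trans
         (ℂ.solve 4 (λ a b w r → a ℂ.:= w ℂ.:+ r ℂ.:+ ((a ℂ.:- b) ℂ.:+ (b ℂ.:- (w ℂ.:+ r)))) refl (f z) (f (corner z)) w r)
         (cong (λ r → w ⊕ r ⊕ e) (sym (cong (λ (i , j) → ν (toℕ i) , ν (toℕ j)) (Fin.remQuot-combine (residue x) (residue y)))))

  colouring : FiniteColoring
  colouring = record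
    { #colors   = M ℕ.* M
    ; class     = λ i z → colour z ≡ i
    ; partition = λ z → colour z , refl , λ eq → eq
    }

  -- Off the grid some ball has a single colour, whereas a boundary point has points both of the
  -- class and of its complement in every ball.
  boundary-OnGrid : ∀ i z → z ∈ Boundary (class colouring i) → OnGrid z
  boundary-OnGrid i z (adherent , coadherent) with em {OnGrid z}
  ... | yes on = on
  ... | no off =
    let ε , 0<ε , same = corner-locally-constant z off
        w , w∈ball , w∈class = adherent ε 0<ε
        v , v∈ball , v∉class = coadherent ε 0<ε
        colour≡ = cong (λ c → let x , y = f c in combine (residue x) (residue y))
    in ⊥-elim (v∉class (trans (colour≡ (trans (same v v∈ball) (sym (same w w∈ball)))) w∈class))

  colouring-jordan : JordanMeasurable colouring
  colouring-jordan i = null-by-lines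
    (×-enumerable (Maybe-enumerable (×-enumerable ℤ-enumerable ℤ-enumerable)) ℤ-enumerable)
    (boundary-OnGrid i _)

  -- The common residue cancels, the lattice parts add up to a lattice point, and each of the 2ⁿ
  -- vertices contributes an error of at most 2 per coordinate.
  monochromatic-alternatingSum : .{{_ : NonZero n}} → ∀ z (u : Vector ℝ² n) i → (∀ r → vertex z u r ∈ class colouring i) →
    ∃ λ w → ∃ λ e → Lattice w × Bounded (ν (2 ^ n ℕ.* 2)) e × ℂ.boxVolume n (ν K , 0#) u ≡ w ⊕ e
  monochromatic-alternatingSum z u i same = Alt w , Alt e
    , ℂ.alternatingSum-closed Lattice lattice-⊖² n (λ r → proj₁ (proj₂ (proj₂ (decomposition r))))
    , alternatingSum-bounded n (λ r → proj₁ (proj₂ (proj₂ (proj₂ (decomposition r)))))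
    , (begin
      ℂ.boxVolume n (ν K , 0#) u        ≡⟨ alternatingSum-vertex n (monomial-leading K n) z u ⟨
      Alt (f ∘ vertex z u)              ≡⟨ ℂ.alternatingSum-cong n (λ r → trans
                                             (proj₂ (proj₂ (proj₂ (proj₂ (decomposition r)))))
                                             (cong (λ i → w r ⊕ colourResidue i ⊕ e r) (same r))) ⟩
      Alt (λ r → w r ⊕ c ⊕ e r)         ≡⟨ ℂ.alternatingSum-+ n _ _ ⟩
      Alt (λ r → w r ⊕ c) ⊕ Alt e       ≡⟨ cong (_⊕ Alt e) (ℂ.alternatingSum-+ n _ _) ⟩
      Alt w ⊕ Alt (λ _ → c) ⊕ Alt e     ≡⟨ cong (λ x → Alt w ⊕ x ⊕ Alt e) (ℂ.alternatingSum-const n c) ⟩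
      Alt w ⊕ 0² ⊕ Alt e                ≡⟨ ℂ.solve 2 (λ w e → w ℂ.:+ ℂ.con 0ℤ ℂ.:+ e ℂ.:= w ℂ.:+ e) refl (Alt w) (Alt e) ⟩
      Alt w ⊕ Alt e                     ∎)
    where
    open ≡-Reasoning
    Alt = ℂ.alternatingSum n
    c = colourResidue i
    decomposition = λ r → f-decomposition (vertex z u r)
    w e : Vec Bool n → ℝ²
    w r = proj₁ (decomposition r)
    e r = proj₁ (proj₂ (decomposition r))

-- Numbers of modulus T lie far from the lattice.

module Separation (R : CompleteOrderedField) where

  open Complex R

  small-multiple-zero : ∀ {c m} i → 0# < m → c < m → Within c (ι i * m) → ι i ≡ 0#
  small-multiple-zero {c} {m} i 0<m c<m within = cong ι (ℤ.≤-antisym (nonpos i (proj₂ within))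
      (subst (0ℤ ℤ.≤_) (ℤ.neg-involutive i) (ℤ.neg-mono-≤ (nonpos (ℤ.- i)
        (subst (_≤ c) (trans (solve 2 (λ i m → :- (i :* m) := (:- i) :* m) refl (ι i) m) (cong (_* m) (sym (ι-neg i))))
          (proj₂ (within-neg within)))))))
    where
    nonpos : ∀ i → ι i * m ≤ c → i ℤ.≤ 0ℤ
    nonpos i im≤c with ≤-<-connex (ι 0ℤ + 1#) (ι i)
    ... | inj₂ i<1 = ι-<-suc⇒≤ i<1
    ... | inj₁ 1≤i = ⊥-elim (≤⇒≯ (≤-trans (*-monoˡ-≤ (inj₁ 0<m) 1≤i) im≤c)
                       (subst (c <_) (solve 1 (λ m → m := (con 0ℤ :+ con 1ℤ) :* m) refl m) c<m))

  -- The multiple of `m` equals `s - e`, whose absolute value is at most T + ε and so less than `m`;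
  -- hence it vanishes.
  near-lattice-zero : ∀ {T ε m s e} i → 0# < m → T + ε < m → Within T s → Within ε e → s ≡ ι i * m + e → s ≡ e
  near-lattice-zero {T} {ε} {m} {s} {e} i 0<m T+ε<m Ts εe s≡ = begin
    s               ≡⟨ s≡ ⟩
    ι i * m + e     ≡⟨ cong (λ x → x * m + e) (small-multiple-zero i 0<m T+ε<m
                         (subst (Within (T + ε)) s-e≡ (within-+ Ts (within-neg εe)))) ⟩
    0# * m + e      ≡⟨ solve 2 (λ m e → con 0ℤ :* m :+ e := e) refl m e ⟩
    e               ∎
    where
    open ≡-Reasoning
    s-e≡ : s - e ≡ ι i * m
    s-e≡ = trans (cong (_- e) s≡) (solve 2 (λ a e → (a :+ e) :- e := a) refl (ι i * m) e)

  normSq-within : ∀ {T s} → 0# ≤ T → normSq s ≡ T * T → Bounded T s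
  normSq-within {T} {x , y} 0≤T eq =
      square-within 0≤T (by-gap-≤ (square-nonneg y) (trans
        (solve 2 (λ x y → y :* y := (x :* x :+ y :* y) :- x :* x) refl x y) (cong (_- x * x) eq)))
    , square-within 0≤T (by-gap-≤ (square-nonneg x) (trans
        (solve 2 (λ x y → x :* x := (x :* x :+ y :* y) :- y :* y) refl x y) (cong (_- y * y) eq)))

  -- The squared norm is at most 2ε², which is less than 4ε² and hence than T². The gap is written
  -- as a sum of these differences.
  bounded-normSq-< : ∀ {ε T s} → 0# < ε → ε + ε ≤ T → Bounded ε s → normSq s < T * T
  bounded-normSq-< {ε} {T} {x , y} 0<ε 2ε≤T (wx , wy) = by-gap-<
    (+-pos (*-pos 0<ε 0<ε) (+-nonneg (*-nonneg (inj₁ 0<ε) (inj₁ 0<ε)) (+-nonneg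
      (+-nonneg (gap-≤ (within-square wx)) (gap-≤ (within-square wy)))
      (*-nonneg (gap-≤ 2ε≤T) (+-nonneg (≤-trans 0≤2ε 2ε≤T) 0≤2ε)))))
    (solve 4 (λ ε T x y → ε :* ε :+ (ε :* ε :+ (((ε :* ε :- x :* x) :+ (ε :* ε :- y :* y))
                            :+ (T :- (ε :+ ε)) :* (T :+ (ε :+ ε))))
                        := T :* T :- (x :* x :+ y :* y)) refl ε T x y)
    where
    0≤2ε : 0# ≤ ε + ε
    0≤2ε = +-nonneg (inj₁ 0<ε) (inj₁ 0<ε)

  -- The only lattice point in reach is 0, which leaves `s` equal to `e`; but `e` is too small to
  -- have modulus T.
  far-from-lattice : ∀ {T ε m s e} i j → 0# < ε → ε + ε ≤ T → T + ε < m → normSq s ≡ T * T → Bounded ε e →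
                     s ≢ (ι i * m , ι j * m) ⊕ e
  far-from-lattice {T} {ε} {m} {s} {e} i j 0<ε 2ε≤T T+ε<m |s|≡T bounded s≡ =
    irrefl |s|≡T (bounded-normSq-< 0<ε 2ε≤T (subst (Bounded ε) (sym s≡e) bounded))
    where
    0≤T : 0# ≤ T
    0≤T = ≤-trans (+-nonneg (inj₁ 0<ε) (inj₁ 0<ε)) 2ε≤T
    0<m : 0# < m
    0<m = ≤-<-trans (+-nonneg 0≤T (inj₁ 0<ε)) T+ε<m
    s≡e : s ≡ e
    s≡e = let wx , wy = normSq-within 0≤T |s|≡T in cong₂ _,_
      (near-lattice-zero i 0<m T+ε<m wx (proj₁ bounded) (cong proj₁ s≡))
      (near-lattice-zero j 0<m T+ε<m wy (proj₂ bounded) (cong proj₂ s≡))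

theorem8 : ExcludedMiddle 0ℓ → (R : CompleteOrderedField) → let open Plane R in
    (n : ℕ) → .{{_ : NonZero n}} →
    Σ FiniteColoring λ χ → JordanMeasurable χ ×
    ((i : Fin (#colors χ)) (z : ℝ²) (u : Vector ℝ² n) (a : Vector ℝ n) →
    (∀ k → 0# < a k) → (∀ k → HasLength (u k) (a k)) → product a ≡ 1# →
    Injective _≡_ _≡_ (vertex z u) →
    ¬ (∀ r → vertex z u r ∈ class χ i))
theorem8 em R n = colouring , colouring-jordan ,
  λ i z u a _ |u|≡a Πa≡1 _ same →
    let w , e , (k , l , w≡) , e-bounded , S≡ = monochromatic-alternatingSum z u i same in
    far-from-lattice k l (ν-mono-< 1≤E) E+E≤T T+E<M
      (trans (normSq-boxVolume n {A = ν K} K² u a |u|≡a) (cong (λ x → x * x) (volume a Πa≡1))) e-bounded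
      (trans S≡ (cong (_⊕ e) w≡))
  where
  -- `E` is the total error, 2 at each of 2ⁿ vertices. `K` is chosen so that the modulus `T` of the
  -- alternating sum is at least 2E, and `M` so that T + E stays below the lattice spacing.
  E K T M : ℕ
  E = 2 ^ n ℕ.* 2
  K = E ℕ.+ E
  T = K ℕ.* n !
  M = T ℕ.+ T

  1≤E : 1 ℕ.≤ E
  1≤E = ℕ.*-mono-≤ (ℕ.m^n>0 2 n) (ℕ.s≤s ℕ.z≤n)

  1≤K : 1 ℕ.≤ K
  1≤K = ℕ.≤-trans 1≤E (ℕ.m≤m+n E E)

  K≤T : K ℕ.≤ T
  K≤T = subst (ℕ._≤ T) (ℕ.*-identityʳ K) (ℕ.*-monoʳ-≤ K (ℕ.1≤n! n))

  E<T : E ℕ.< T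
  E<T = ℕ.<-≤-trans (ℕ.m<m+n E 1≤E) K≤T

  instance
    M≢0 : NonZero M
    M≢0 = ℕ.>-nonZero (ℕ.<-≤-trans 1≤K (ℕ.≤-trans K≤T (ℕ.m≤m+n T T)))

  open Complex R
  open Colouring em R K n M 1≤K
  open Separation R

  E+E≤T : ν E + ν E ≤ ν T
  E+E≤T = subst (_≤ ν T) (ν-+ E E) (ν-mono-≤ K≤T)

  T+E<M : ν T + ν E < ν M
  T+E<M = subst (_< ν M) (ν-+ T E) (ν-mono-< (ℕ.+-monoʳ-< T E<T))

  K² : normSq (ν K , 0#) ≡ ν K * ν K
  K² = solve 1 (λ a → a :* a :+ con 0ℤ :* con 0ℤ := a :* a) refl (ν K)

  volume : ∀ a → product a ≡ 1# → ν K * ν (n !) * product a ≡ ν T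
  volume a Πa≡1 = trans (cong (ν K * ν (n !) *_) Πa≡1) (trans
    (solve 2 (λ a b → a :* b :* con 1ℤ := a :* b) refl (ν K) (ν (n !))) (sym (ν-* K (n !))))
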